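{- Let $M$ be a matroid and let $c$ be the size of a largest circuit of $M$, with $c=1$ if $M$ has no circuits. Then $\log_2 c\le\mathrm{cd}(M)\le c(c+1)/2$.
   Context: Contraction depth $\mathrm{cd}$ of a matroid $M$ is defined recursively: $\mathrm{cd}(M)=0$ if $E(M)=\emptyset$; if $M$ is disconnected, $\mathrm{cd}(M)$ is the maximum contraction depth of its connected components; if $M$ is connected and $E(M)\ne\emptyset$, $\mathrm{cd}(M)$ is the minimum $k$ such that $\mathrm{cd}(M/e)\le k-1$ for some $e\in E(M)$. -}

module Defs where

open import Data.Nat using (ℕ; zero; suc; _≤_; _<_; _∸_)
open import Data.Nat.Base using (_+_)
open import Data.Fin using (Fin)
open import Data.Fin.Subset
  using (Subset; _∈_; _∉_; _⊆_; _⊂_; _∪_; _∩_; _-_; ⁅_⁆; ∣_∣)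
open import Data.Product using (Σ; _×_; ∃; ∃-syntax)
open import Data.Sum using (_⊎_)
open import Relation.Binary.PropositionalEquality using (_≡_)
open import Relation.Nullary using (¬_)

-- A (finite) matroid given by its rank function.  The ground set is a
-- subset E of Fin n; the rank function r is only meaningful on subsets
-- of E.  "Raw" data, the matroid axioms are a separate predicate so that
-- minors can be formed without carrying proofs.
record RawMatroid (n : ℕ) : Set where
  constructor mkMatroid
  field
    E : Subset n
    r : Subset n → ℕ
open RawMatroid public

record IsMatroid {n : ℕ} (M : RawMatroid n) : Set where
  field
    r-bound   : ∀ X → X ⊆ E M → r M X ≤ ∣ X ∣
    r-mono    : ∀ X Y → X ⊆ Y → Y ⊆ E M → r M X ≤ r M Y
    r-submod  : ∀ X Y → X ⊆ E M → Y ⊆ E M →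
                r M (X ∪ Y) + r M (X ∩ Y) ≤ r M X + r M Y

module _ {n : ℕ} (M : RawMatroid n) where

  Independent : Subset n → Set
  Independent X = X ⊆ E M × r M X ≡ ∣ X ∣

  Dependent : Subset n → Set
  Dependent X = X ⊆ E M × ¬ (r M X ≡ ∣ X ∣)

  Circuit : Subset n → Set
  Circuit C = Dependent C × (∀ D → D ⊂ C → Independent D)

  Related : Fin n → Fin n → Set
  Related e f = e ≡ f ⊎ (∃[ C ] (Circuit C × e ∈ C × f ∈ C))

  Connected : Set
  Connected = ∀ e f → e ∈ E M → f ∈ E M → Related e f

  IsComponent : Subset n → Set
  IsComponent C = ∃[ e ] (e ∈ E M ×
                    (∀ f → (f ∈ C → f ∈ E M × Related e f)
                         × (f ∈ E M × Related e f → f ∈ C)))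

  LargestCircuitSize : ℕ → Set
  LargestCircuitSize c =
      ((∃[ C ] (Circuit C × ∣ C ∣ ≡ c)) × (∀ C → Circuit C → ∣ C ∣ ≤ c))
    ⊎ ((∀ C → ¬ Circuit C) × c ≡ 1)

_／_ : ∀ {n} → RawMatroid n → Fin n → RawMatroid n
M ／ e = mkMatroid (E M - e) (λ X → r M (X ∪ ⁅ e ⁆) ∸ r M ⁅ e ⁆)

_∣ʳ_ : ∀ {n} → RawMatroid n → Subset n → RawMatroid n
M ∣ʳ C = mkMatroid C (r M)

-- CdLe M k  means  cd(M) ≤ k, following the recursive definition of
-- contraction depth:
--  * cd(M) = 0 if E(M) = ∅;
--  * if M is disconnected, cd(M) = max of cd of its components;
--  * if M is connected and nonempty, cd(M) = min over e of 1 + cd(M/e).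
data CdLe {n : ℕ} : RawMatroid n → ℕ → Set where
  cd-empty : ∀ {M k} → (∀ x → x ∉ E M) → CdLe M k
  cd-disc  : ∀ {M k} → ¬ Connected M →
             (∀ C → IsComponent M C → CdLe (M ∣ʳ C) k) → CdLe M k
  cd-conn  : ∀ {M k} e → Connected M → e ∈ E M →
             CdLe (M ／ e) k → CdLe M (suc k)

{-# OPTIONS --safe #-}
module Submission where

-- Lower bound: if C is a circuit, M / e has a circuit contained in C of size at least |C| / 2,
-- because if C has nullity 2 in M / e it is covered by two circuits of M / e.
--
-- Upper bound: if M is connected and C is a largest circuit, then every circuit D of M / C is
-- shorter than C, so contracting C and recursing costs at most c + (c - 1) + ... + 1. If D is
-- independent in M, then D together with a nonempty part of C is a circuit. Otherwise D is a
-- circuit of M skew to C. Let A be minimal, disjoint from C ∪ D, such that C and D are no longer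
-- skew in M / A (connectedness provides such a set). Then C and D are circuits of M / A, their
-- local connectivity there is exactly 1, and at least half of C, at least half of D and all of A
-- form a circuit of M, so that |C| + |D| + 2 ≤ 2 |C|.

open import Defs
open import Data.Nat using (ℕ; suc; _*_; _^_; _≤_; _/_)
open import Data.Product using (_×_)
open import Algebra.Properties.CommutativeSemigroup using (interchange)
open import Data.Bool using (Bool; true; false; _∧_; _∨_; not; T)
open import Data.Bool.Properties using (T-≡)
open import Data.Empty using (⊥-elim)
open import Data.Fin using (Fin; zero; suc)
open import Data.Fin.Properties using () renaming (_≟_ to _≟ᶠ_; all? to allᶠ?; any? to anyᶠ?)
open import Data.Fin.Subset
open import Data.Fin.Subset.Properties
open import Data.Nat using (zero; _+_; _∸_; _<_; z≤n; s≤s; s≤s⁻¹; _≤?_; _≤ᵇ_)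
open import Data.Nat.DivMod using (m*n/n≡m)
open import Data.Nat.Properties
open import Data.Product using (∃; _,_; proj₁; proj₂)
open import Data.Sum using (_⊎_; inj₁; inj₂)
open import Data.Vec using (Vec; []; _∷_; map; zipWith; lookup; tabulate; allFin)
open import Data.Vec.N-ary using (N-ary; _$ⁿ_; ∀ⁿ; curryⁿ)
open import Data.Vec.Properties
  using (lookup-map; lookup-zipWith; lookup-replicate; lookup⇒[]=; []=⇒lookup; lookup∘tabulate)
open import Function using (_∘_; id; case_of_)
open import Function.Bundles using (Equivalence)
open import Relation.Binary.PropositionalEquality
open import Relation.Nullary using (¬_; Dec; yes; no; does)
open import Relation.Nullary.Decidable using (_×-dec_; _⊎-dec_; _→-dec_; map′; decidable-stable; dec-true)

-- One fact drives both bounds: a set of nullity 2 without coloops is covered by two circuits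
-- properly inside it. It gives the halving under contraction, the circuit through a prescribed
-- element in `extend-circuit`, and the halves of `C` and `D` in `long-circuit`. The obstacle in the
-- upper bound is that contracting a circuit one element at a time may disconnect the matroid before
-- the circuit is used up. Hence `cd-bound` carries the set `S` still to be contracted, together
-- with a bound on the circuits of the contraction by all of `S`. Passing to a component `K`
-- replaces `S` by `S ∩ K`, and `component-contract` shows that the bound survives. Rank functions
-- are taken on all subsets of `Fin n`, with contracted elements kept as loops. Restriction then
-- leaves the function alone, and ground sets are tracked separately.

infixr 5 _⇒_
infix  6 ⊢_
infix  7 _≼_

-- Shared by two reflective solvers: `a ≼ b` is read as an inclusion of sets in one and as an
-- inequality of numbers in the other.
data Sequent (E : Set) : Set where
  ⊢_  : E × E → Sequent E
  _⇒_ : E × E → Sequent E → Sequent E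

_≼_ : {E : Set} → E → E → E × E
_≼_ = _,_

module _ {E V : Set} (_⊑_ : V → V → Set) (⟦_⟧ : E → V) where

  Holds : Sequent E → Set
  Holds (⊢ (a , b))       = ⟦ a ⟧ ⊑ ⟦ b ⟧
  Holds ((a , b) ⇒ s) = ⟦ a ⟧ ⊑ ⟦ b ⟧ → Holds s

-- Lets a sequent be written as a function of its variables, so that goals show names instead of de
-- Bruijn indices.
close : ∀ {E : ℕ → Set} → (∀ {k} → Fin k → E k) →
        ∀ k {A : Set} → N-ary k (E k) A → A
close v k f = f $ⁿ map v (allFin k)

uncurryⁿ : ∀ {A : Set} k {P : Vec A k → Set} → (∀ v → P v) → ∀ⁿ k (curryⁿ P)
uncurryⁿ zero    h = h []
uncurryⁿ (suc k) h = λ x → uncurryⁿ k (λ v → h (x ∷ v))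

-- Inclusions between Boolean combinations of subsets, by truth tables.

module SetSolver where

  infixl 8 _:∪_ _:∩_ _:─_

  data Expr (k : ℕ) : Set where
    var            : Fin k → Expr k
    ∅              : Expr k
    _:∪_ _:∩_ _:─_ : Expr k → Expr k → Expr k

  ⟦_⟧ : ∀ {k n} → Expr k → Vec (Subset n) k → Subset n
  ⟦ var i  ⟧ γ = lookup γ i
  ⟦ ∅      ⟧ γ = ⊥
  ⟦ a :∪ b ⟧ γ = ⟦ a ⟧ γ ∪ ⟦ b ⟧ γ
  ⟦ a :∩ b ⟧ γ = ⟦ a ⟧ γ ∩ ⟦ b ⟧ γ
  ⟦ a :─ b ⟧ γ = ⟦ a ⟧ γ ─ ⟦ b ⟧ γ

  eval : ∀ {k} → Expr k → Vec Bool k → Bool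
  eval (var i)  v = lookup v i
  eval ∅        v = false
  eval (a :∪ b) v = eval a v ∨ eval b v
  eval (a :∩ b) v = eval a v ∧ eval b v
  eval (a :─ b) v = eval a v ∧ not (eval b v)

  lookup-─ : ∀ {n} (p q : Subset n) i → lookup (p ─ q) i ≡ lookup p i ∧ not (lookup q i)
  lookup-─ (true  ∷ p) (true  ∷ q) zero    = refl
  lookup-─ (true  ∷ p) (false ∷ q) zero    = refl
  lookup-─ (false ∷ p) (true  ∷ q) zero    = refl
  lookup-─ (false ∷ p) (false ∷ q) zero    = refl
  lookup-─ (_     ∷ p) (_     ∷ q) (suc i) = lookup-─ p q i

  at : ∀ {k n} → Vec (Subset n) k → Fin n → Vec Bool k
  at γ i = map (λ p → lookup p i) γ

  lookup-⟦⟧ : ∀ {k n} (e : Expr k) (γ : Vec (Subset n) k) i →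
              lookup (⟦ e ⟧ γ) i ≡ eval e (at γ i)
  lookup-⟦⟧ (var j)  γ i = sym (lookup-map j (λ p → lookup p i) γ)
  lookup-⟦⟧ ∅        γ i = lookup-replicate i false
  lookup-⟦⟧ (a :∪ b) γ i = trans (lookup-zipWith _∨_ i (⟦ a ⟧ γ) (⟦ b ⟧ γ))
                                 (cong₂ _∨_ (lookup-⟦⟧ a γ i) (lookup-⟦⟧ b γ i))
  lookup-⟦⟧ (a :∩ b) γ i = trans (lookup-zipWith _∧_ i (⟦ a ⟧ γ) (⟦ b ⟧ γ))
                                 (cong₂ _∧_ (lookup-⟦⟧ a γ i) (lookup-⟦⟧ b γ i))
  lookup-⟦⟧ (a :─ b) γ i = trans (lookup-─ (⟦ a ⟧ γ) (⟦ b ⟧ γ) i)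
                                 (cong₂ (λ x y → x ∧ not y) (lookup-⟦⟧ a γ i) (lookup-⟦⟧ b γ i))

  ∈⇒eval : ∀ {k n} (e : Expr k) (γ : Vec (Subset n) k) {i} → i ∈ ⟦ e ⟧ γ → eval e (at γ i) ≡ true
  ∈⇒eval e γ {i} i∈ = trans (sym (lookup-⟦⟧ e γ i)) ([]=⇒lookup i∈)

  eval⇒∈ : ∀ {k n} (e : Expr k) (γ : Vec (Subset n) k) {i} → eval e (at γ i) ≡ true → i ∈ ⟦ e ⟧ γ
  eval⇒∈ e γ {i} p = lookup⇒[]= i (⟦ e ⟧ γ) (trans (lookup-⟦⟧ e γ i) p)

  imp : Bool → Bool → Bool
  imp true  y = y
  imp false y = true

  valid : ∀ {k} → Sequent (Expr k) → Vec Bool k → Bool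
  valid (⊢ (a , b))   v = imp (eval a v) (eval b v)
  valid ((a , b) ⇒ s) v = imp (imp (eval a v) (eval b v)) (valid s v)

  imp-elim : ∀ {x y} → imp x y ≡ true → x ≡ true → y ≡ true
  imp-elim p refl = p

  imp-intro : ∀ x {y} → (x ≡ true → y ≡ true) → imp x y ≡ true
  imp-intro true  h = h refl
  imp-intro false h = refl

  -- Inclusion is pointwise: at each element the hypotheses become implications between membership
  -- bits, and one truth table serves all elements.
  sound : ∀ {k n} (s : Sequent (Expr k)) (γ : Vec (Subset n) k) →
          (∀ i → valid s (at γ i) ≡ true) → Holds _⊆_ (λ e → ⟦ e ⟧ γ) s
  sound (⊢ (a , b))   γ h {i} i∈ = eval⇒∈ b γ (imp-elim (h i) (∈⇒eval a γ i∈))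
  sound ((a , b) ⇒ s) γ h a⊆b = sound s γ λ i →
    imp-elim (h i) (imp-intro (eval a (at γ i)) λ p → ∈⇒eval b γ (a⊆b (eval⇒∈ a γ p)))

  tautology : ∀ k → (Vec Bool k → Bool) → Bool
  tautology zero    f = f []
  tautology (suc k) f = tautology k (λ v → f (true ∷ v)) ∧ tautology k (λ v → f (false ∷ v))

  tautology-sound : ∀ k f → T (tautology k f) → ∀ v → f v ≡ true
  tautology-sound zero    f t [] = Equivalence.to T-≡ t
  tautology-sound (suc k) f t (b ∷ v)
    with tautology k (λ w → f (true ∷ w)) in p | b
  ... | true | true  = tautology-sound k (λ w → f (true ∷ w)) (Equivalence.from T-≡ p) v
  ... | true | false = tautology-sound k (λ w → f (false ∷ w)) t v

  abstract
    -- The implicit argument reduces to the unit type when the truth table is valid, and is then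
    -- filled in by eta.
    ⊆-by : ∀ {n} k (f : N-ary k (Expr k) (Sequent (Expr k))) →
           {T (tautology k (valid (close var k f)))} →
           ∀ⁿ k (curryⁿ λ (γ : Vec (Subset n) k) → Holds _⊆_ (λ e → ⟦ e ⟧ γ) (close var k f))
    ⊆-by k f {t} = uncurryⁿ k λ γ →
      sound (close var k f) γ λ i → tautology-sound k _ t (at γ i)

-- Linear inequalities between natural numbers.

module LinearSolver where

  infixl 8 _:+_

  data Expr (k : ℕ) : Set where
    var  : Fin k → Expr k
    con  : ℕ → Expr k
    _:+_ : Expr k → Expr k → Expr k

  ⟦_⟧ : ∀ {k} → Expr k → Vec ℕ k → ℕ
  ⟦ var i  ⟧ γ = lookup γ i
  ⟦ con c  ⟧ γ = c
  ⟦ a :+ b ⟧ γ = ⟦ a ⟧ γ + ⟦ b ⟧ γ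

  dot : ∀ {k} → Vec ℕ k → Vec ℕ k → ℕ
  dot []       []      = 0
  dot (c ∷ cs) (x ∷ γ) = c * x + dot cs γ

  zeros : ∀ k → Vec ℕ k
  zeros zero    = []
  zeros (suc k) = 0 ∷ zeros k

  unit : ∀ {k} → Fin k → Vec ℕ k
  unit {suc k} zero    = 1 ∷ zeros k
  unit         (suc i) = 0 ∷ unit i

  -- The head coefficient is the constant term.
  normal : ∀ {k} → Expr k → Vec ℕ (suc k)
  normal     (var i)  = unit (suc i)
  normal {k} (con c)  = c ∷ zeros k
  normal     (a :+ b) = zipWith _+_ (normal a) (normal b)

  dot-zeros : ∀ {k} (γ : Vec ℕ k) → dot (zeros k) γ ≡ 0
  dot-zeros []      = refl
  dot-zeros (x ∷ γ) = dot-zeros γ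

  dot-unit : ∀ {k} (i : Fin k) γ → dot (unit i) γ ≡ lookup γ i
  dot-unit zero    (x ∷ γ) =
    trans (cong₂ _+_ (*-identityˡ x) (dot-zeros γ)) (+-identityʳ x)
  dot-unit (suc i) (x ∷ γ) = dot-unit i γ

  dot-+ : ∀ {k} (as bs γ : Vec ℕ k) → dot (zipWith _+_ as bs) γ ≡ dot as γ + dot bs γ
  dot-+ []       []       []      = refl
  dot-+ (a ∷ as) (b ∷ bs) (x ∷ γ) =
    trans (cong₂ _+_ (*-distribʳ-+ x a b) (dot-+ as bs γ)) (interchange +-commutativeSemigroup (a * x) (b * x) _ _)

  dot-normal : ∀ {k} (e : Expr k) γ → dot (normal e) (1 ∷ γ) ≡ ⟦ e ⟧ γ
  dot-normal (var i)  γ = dot-unit (suc i) (1 ∷ γ)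
  dot-normal (con c)  γ =
    trans (cong₂ _+_ (*-identityʳ c) (dot-zeros γ)) (+-identityʳ c)
  dot-normal (a :+ b) γ =
    trans (dot-+ (normal a) (normal b) (1 ∷ γ)) (cong₂ _+_ (dot-normal a γ) (dot-normal b γ))

  leq : ∀ {k} → Vec ℕ k → Vec ℕ k → Bool
  leq []       []       = true
  leq (a ∷ as) (b ∷ bs) = (a ≤ᵇ b) ∧ leq as bs

  leq-sound : ∀ {k} (as bs γ : Vec ℕ k) → T (leq as bs) → dot as γ ≤ dot bs γ
  leq-sound []       []       []      t = z≤n
  leq-sound (a ∷ as) (b ∷ bs) (x ∷ γ) t with a ≤ᵇ b in p
  ... | true = +-mono-≤ (*-monoˡ-≤ x (≤ᵇ⇒≤ a b (Equivalence.from T-≡ p))) (leq-sound as bs γ t)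

  -- A sequent is accepted when adding up all its hypotheses L ≤ R turns the goal a ≤ b
  -- into a + R ≤ b + L coefficient by coefficient.
  valid : ∀ {k} → Expr k → Expr k → Sequent (Expr k) → Bool
  valid L R (⊢ (a , b))   = leq (normal (a :+ R)) (normal (b :+ L))
  valid L R ((a , b) ⇒ s) = valid (L :+ a) (R :+ b) s

  -- From `a + R ≤ b + L` and `L ≤ R` follows `a + R ≤ b + R`, and `R` cancels. Each hypothesis
  -- enters with weight one, so one that is needed twice has to be listed twice.
  sound : ∀ {k} (s : Sequent (Expr k)) L R γ → T (valid L R s) → ⟦ L ⟧ γ ≤ ⟦ R ⟧ γ →
          Holds _≤_ (λ e → ⟦ e ⟧ γ) s
  sound (⊢ (a , b)) L R γ t L≤R = +-cancelʳ-≤ (⟦ R ⟧ γ) (⟦ a ⟧ γ) (⟦ b ⟧ γ) (begin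
    ⟦ a :+ R ⟧ γ                  ≡⟨ sym (dot-normal (a :+ R) γ) ⟩
    dot (normal (a :+ R)) (1 ∷ γ) ≤⟨ leq-sound (normal (a :+ R)) (normal (b :+ L)) (1 ∷ γ) t ⟩
    dot (normal (b :+ L)) (1 ∷ γ) ≡⟨ dot-normal (b :+ L) γ ⟩
    ⟦ b :+ L ⟧ γ              ≤⟨ +-monoʳ-≤ (⟦ b ⟧ γ) L≤R ⟩
    ⟦ b :+ R ⟧ γ              ∎)
    where open ≤-Reasoning
  sound ((a , b) ⇒ s) L R γ t L≤R a≤b =
    sound s (L :+ a) (R :+ b) γ t (+-mono-≤ L≤R a≤b)

  abstract
    ≤-by : ∀ k (f : N-ary k (Expr k) (Sequent (Expr k))) →
           {T (valid (con 0) (con 0) (close var k f))} →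
           ∀ⁿ k (curryⁿ λ (γ : Vec ℕ k) → Holds _≤_ (λ e → ⟦ e ⟧ γ) (close var k f))
    ≤-by k f {t} = uncurryⁿ k λ γ → sound (close var k f) (con 0) (con 0) γ t z≤n

open SetSolver using (∅; _:∪_; _:∩_; _:─_; ⊆-by)
open LinearSolver using (con; _:+_; ≤-by)

-- Cardinalities of subsets and deletion-minimal subsets.

abstract

  ⁅⁆⊆ : ∀ {n} {X : Subset n} {x} → x ∈ X → ⁅ x ⁆ ⊆ X
  ⁅⁆⊆ {x = x} x∈X y∈ with x∈⁅y⁆⇒x≡y x y∈
  ... | refl = x∈X

  ∉⇒disjoint : ∀ {n} {X : Subset n} {x} → x ∉ X → ⁅ x ⁆ ∩ X ⊆ ⊥
  ∉⇒disjoint {X = X} {x} x∉X y∈ with x∈p∩q⁻ ⁅ x ⁆ X y∈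
  ... | y∈⁅x⁆ , y∈X with x∈⁅y⁆⇒x≡y x y∈⁅x⁆
  ... | refl = ⊥-elim (x∉X y∈X)

  ⊆-delete : ∀ {n} {X Y : Subset n} {x} → X ⊆ Y → x ∉ X → X ⊆ Y - x
  ⊆-delete {X = X} {Y} {x} X⊆Y x∉X =
    ⊆-by 3 (λ a b s → a ≼ b ⇒ s :∩ a ≼ ∅ ⇒ ⊢ a ≼ b :─ s) X Y ⁅ x ⁆ X⊆Y (∉⇒disjoint x∉X)

  ∉-delete : ∀ {n} (X : Subset n) x → x ∉ X - x
  ∉-delete X x x∈ = ∉⊥ (⊆-by 2 (λ a s → ⊢ (a :─ s) :∩ s ≼ ∅) X ⁅ x ⁆ (x∈p∩q⁺ (x∈ , x∈⁅x⁆ x)))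

  ∣∪∣+∣∩∣ : ∀ {n} (p q : Subset n) → ∣ p ∪ q ∣ + ∣ p ∩ q ∣ ≡ ∣ p ∣ + ∣ q ∣
  ∣∪∣+∣∩∣ []          []          = refl
  ∣∪∣+∣∩∣ (true  ∷ p) (true  ∷ q) =
    cong suc (trans (+-suc _ _) (trans (cong suc (∣∪∣+∣∩∣ p q)) (sym (+-suc _ _))))
  ∣∪∣+∣∩∣ (true  ∷ p) (false ∷ q) = cong suc (∣∪∣+∣∩∣ p q)
  ∣∪∣+∣∩∣ (false ∷ p) (true  ∷ q) = trans (cong suc (∣∪∣+∣∩∣ p q)) (sym (+-suc _ _))
  ∣∪∣+∣∩∣ (false ∷ p) (false ∷ q) = ∣∪∣+∣∩∣ p q

  card-cover : ∀ {n} {Z : Subset n} X Y → Z ⊆ X ∪ Y → ∣ Z ∣ ≤ ∣ X ∣ + ∣ Y ∣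
  card-cover {Z = Z} X Y Z⊆ =
    ≤-by 5 (λ z u i x y → z ≼ u ⇒ u :+ i ≼ x :+ y ⇒ ⊢ z ≼ x :+ y)
      (∣ Z ∣) (∣ X ∪ Y ∣) (∣ X ∩ Y ∣) (∣ X ∣) (∣ Y ∣)
      (p⊆q⇒∣p∣≤∣q∣ Z⊆) (≤-reflexive (∣∪∣+∣∩∣ X Y))

  card-disjoint : ∀ {n} {Z : Subset n} X Y → X ∩ Y ⊆ ⊥ → X ∪ Y ⊆ Z → ∣ X ∣ + ∣ Y ∣ ≤ ∣ Z ∣
  card-disjoint {n} {Z} X Y X∩Y⊆⊥ ⊆Z =
    ≤-by 5 (λ z u i x y → u ≼ z ⇒ i ≼ con 0 ⇒ x :+ y ≼ u :+ i ⇒ ⊢ x :+ y ≼ z)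
      (∣ Z ∣) (∣ X ∪ Y ∣) (∣ X ∩ Y ∣) (∣ X ∣) (∣ Y ∣)
      (p⊆q⇒∣p∣≤∣q∣ ⊆Z) (≤-trans (p⊆q⇒∣p∣≤∣q∣ X∩Y⊆⊥) (≤-reflexive (∣⊥∣≡0 n)))
      (≤-reflexive (sym (∣∪∣+∣∩∣ X Y)))

  card-delete-≤ : ∀ {n} (X : Subset n) x → ∣ X ∣ ≤ ∣ X - x ∣ + 1
  card-delete-≤ X x = subst (λ k → ∣ X ∣ ≤ ∣ X - x ∣ + k) (∣⁅x⁆∣≡1 x)
    (card-cover (X - x) ⁅ x ⁆ (⊆-by 2 (λ a s → ⊢ a ≼ (a :─ s) :∪ s) X ⁅ x ⁆))

  card-delete-≥ : ∀ {n} {X : Subset n} {x} → x ∈ X → ∣ X - x ∣ + 1 ≤ ∣ X ∣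
  card-delete-≥ {X = X} {x} x∈X = subst (λ k → ∣ X - x ∣ + k ≤ ∣ X ∣) (∣⁅x⁆∣≡1 x)
    (card-disjoint (X - x) ⁅ x ⁆ (⊆-by 2 (λ a s → ⊢ (a :─ s) :∩ s ≼ ∅) X ⁅ x ⁆)
      (⊆-by 2 (λ a s → s ≼ a ⇒ ⊢ (a :─ s) :∪ s ≼ a) X ⁅ x ⁆ (⁅⁆⊆ x∈X)))

  0<card⇒nonempty : ∀ {n} (X : Subset n) → 0 < ∣ X ∣ → Nonempty X
  0<card⇒nonempty {n} X 0<∣X∣ with nonempty? X
  ... | yes ne = ne
  ... | no  e  = ⊥-elim (<-irrefl refl (subst (0 <_) (trans (cong ∣_∣ (Empty-unique e)) (∣⊥∣≡0 n)) 0<∣X∣))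

  ∃∉ : ∀ {n} (X Y : Subset n) → ¬ X ⊆ Y → ∃ λ x → x ∈ X × x ∉ Y
  ∃∉ X Y X⊈Y with nonempty? (X ─ Y)
  ... | yes (x , x∈) = x , p─q⊆p X Y x∈ , λ x∈Y →
          ∉⊥ (⊆-by 2 (λ a b → ⊢ (a :─ b) :∩ b ≼ ∅) X Y (x∈p∩q⁺ (x∈ , x∈Y)))
  ... | no  e = ⊥-elim (X⊈Y (⊆-by 2 (λ a b → a :─ b ≼ ∅ ⇒ ⊢ a ≼ b) X Y
          (λ x∈ → ⊥-elim (e (_ , x∈)))))

  -- Elements are removed as long as `P` survives. The result is minimal against single deletions,
  -- which is the form that the rank arguments use.
  minimal-subset : ∀ {n} {P : Subset n → Set} → (∀ X → Dec (P X)) → ∀ X → P X →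
                   ∃ λ Y → Y ⊆ X × P Y × (∀ {y} → y ∈ Y → ¬ P (Y - y))
  minimal-subset {n} {P} P? X PX = go ∣ X ∣ X ≤-refl PX
    where
    go : ∀ k X → ∣ X ∣ ≤ k → P X → ∃ λ Y → Y ⊆ X × P Y × (∀ {y} → y ∈ Y → ¬ P (Y - y))
    go k X ∣X∣≤k PX with anyᶠ? (λ y → (y ∈? X) ×-dec P? (X - y))
    ... | no  none = X , id , PX , λ y∈X PX-y → none (_ , y∈X , PX-y)
    go zero    X ∣X∣≤k PX | yes (y , y∈X , _) = ⊥-elim (<-irrefl refl
      (≤-by 2 (λ x d → d :+ con 1 ≼ x ⇒ x ≼ con 0 ⇒ ⊢ con 1 ≼ con 0)
        (∣ X ∣) (∣ X - y ∣) (card-delete-≥ y∈X) ∣X∣≤k))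
    go (suc k) X ∣X∣≤k PX | yes (y , y∈X , PX-y) =
      let Y , Y⊆ , rest = go k (X - y)
            (≤-by 3 (λ x d z → d :+ con 1 ≼ x ⇒ x ≼ con 1 :+ z ⇒ ⊢ d ≼ z)
              (∣ X ∣) (∣ X - y ∣) k (card-delete-≥ y∈X) ∣X∣≤k) PX-y
      in Y , p─q⊆p X ⁅ y ⁆ ∘ Y⊆ , rest

-- Rank functions, independence, circuits and contraction.

record IsRank {n : ℕ} (ρ : Subset n → ℕ) : Set where
  field
    bound  : ∀ X → ρ X ≤ ∣ X ∣
    mono   : ∀ {X Y} → X ⊆ Y → ρ X ≤ ρ Y
    submod : ∀ X Y → ρ (X ∪ Y) + ρ (X ∩ Y) ≤ ρ X + ρ Y

  submod-⊆ : ∀ {U I} X Y → U ⊆ X ∪ Y → I ⊆ X ∩ Y → ρ U + ρ I ≤ ρ X + ρ Y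
  submod-⊆ X Y U⊆ I⊆ = ≤-trans (+-mono-≤ (mono U⊆) (mono I⊆)) (submod X Y)

open IsRank

-- An inequality in place of the equality: `bound` supplies the other half, and the linear solver
-- takes it as it stands.
Indep : ∀ {n} → (Subset n → ℕ) → Subset n → Set
Indep ρ X = ∣ X ∣ ≤ ρ X

Dep : ∀ {n} → (Subset n → ℕ) → Subset n → Set
Dep ρ X = ρ X + 1 ≤ ∣ X ∣

abstract

  ¬Indep⇒Dep : ∀ {n} {ρ : Subset n → ℕ} {X} → ¬ Indep ρ X → Dep ρ X
  ¬Indep⇒Dep {ρ = ρ} {X} ¬i = subst (_≤ ∣ X ∣) (sym (+-comm (ρ X) 1)) (≰⇒> ¬i)

  ¬Dep⇒Indep : ∀ {n} {ρ : Subset n → ℕ} {X} → ¬ Dep ρ X → Indep ρ X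
  ¬Dep⇒Indep {ρ = ρ} {X} ¬d = decidable-stable (∣ X ∣ ≤? ρ X) (λ ¬i → ¬d (¬Indep⇒Dep {ρ = ρ} ¬i))

  dep⇒¬indep : ∀ {n} {ρ : Subset n → ℕ} {X} → Dep ρ X → ¬ Indep ρ X
  dep⇒¬indep {ρ = ρ} {X} d i = 1+n≰n
    (≤-by 2 (λ r x → r :+ con 1 ≼ x ⇒ x ≼ r ⇒ ⊢ con 1 ≼ con 0) (ρ X) (∣ X ∣) d i)

-- Only single deletions are recorded; `circ-⊂` recovers all proper subsets, since independence is
-- hereditary.
record Circ {n : ℕ} (ρ : Subset n → ℕ) (C : Subset n) : Set where
  constructor circ
  field
    dependent : Dep ρ C
    delete    : ∀ {x} → x ∈ C → Indep ρ (C - x)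

open Circ

infixl 6 _⫽_

-- Contraction without shrinking the ground set: the elements of B become loops.
_⫽_ : ∀ {n} → (Subset n → ℕ) → Subset n → Subset n → ℕ
(ρ ⫽ B) X = ρ (X ∪ B) ∸ ρ B

module _ {n : ℕ} {ρ : Subset n → ℕ} (R : IsRank ρ) where

  abstract

    -- Nullity is cardinality minus rank, here with the subtraction moved across. Adding `X ─ Y`
    -- raises the rank by at most its cardinality.
    nullity-mono : ∀ {X Y} → Y ⊆ X → ρ X + ∣ Y ∣ ≤ ρ Y + ∣ X ∣
    nullity-mono {X} {Y} Y⊆X =
      ≤-by 7 (λ rx ry rd r0 d x y → rx :+ r0 ≼ ry :+ rd ⇒ rd ≼ d ⇒ y :+ d ≼ x ⇒ ⊢ rx :+ y ≼ ry :+ x)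
        (ρ X) (ρ Y) (ρ (X ─ Y)) (ρ ⊥) (∣ X ─ Y ∣) (∣ X ∣) (∣ Y ∣)
        (submod-⊆ R Y (X ─ Y) (⊆-by 2 (λ x y → ⊢ x ≼ y :∪ (x :─ y)) X Y) (⊆-min _))
        (bound R (X ─ Y))
        (card-disjoint Y (X ─ Y) (⊆-by 2 (λ x y → ⊢ y :∩ (x :─ y) ≼ ∅) X Y)
          (⊆-by 2 (λ x y → y ≼ x ⇒ ⊢ y :∪ (x :─ y) ≼ x) X Y Y⊆X))

    indep-⊆ : ∀ {X Y} → Y ⊆ X → Indep ρ X → Indep ρ Y
    indep-⊆ {X} {Y} Y⊆X = ≤-by 4 (λ rx ry x y → rx :+ y ≼ ry :+ x ⇒ x ≼ rx ⇒ ⊢ y ≼ ry)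
      (ρ X) (ρ Y) (∣ X ∣) (∣ Y ∣) (nullity-mono Y⊆X)

    dep⇒circ : ∀ {X} → Dep ρ X → ∃ λ C → C ⊆ X × Circ ρ C
    dep⇒circ {X} d with minimal-subset (λ Y → ρ Y + 1 ≤? ∣ Y ∣) X d
    ... | C , C⊆X , dC , minC = C , C⊆X , circ dC (λ x∈ → ¬Dep⇒Indep {ρ = ρ} (minC x∈))

    circ-nonempty : ∀ {C} → Circ ρ C → Nonempty C
    circ-nonempty {C} c = 0<card⇒nonempty C (≤-by 2 (λ r x → r :+ con 1 ≼ x ⇒ ⊢ con 1 ≼ x)
      (ρ C) (∣ C ∣) (dependent c))

    circ-⊂ : ∀ {C D} → Circ ρ C → D ⊂ C → Indep ρ D
    circ-⊂ c (D⊆C , x , x∈C , x∉D) = indep-⊆ (⊆-delete D⊆C x∉D) (delete c x∈C)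

    circ-rank : ∀ {C} → Circ ρ C → ∣ C ∣ ≤ ρ C + 1
    circ-rank {C} c with circ-nonempty c
    ... | x , x∈C = ≤-by 4 (λ k d rd r → k ≼ d :+ con 1 ⇒ d ≼ rd ⇒ rd ≼ r ⇒ ⊢ k ≼ r :+ con 1)
      (∣ C ∣) (∣ C - x ∣) (ρ (C - x)) (ρ C)
      (card-delete-≤ C x) (delete c x∈C) (mono R (p─q⊆p C ⁅ x ⁆))

    -- Submodularity of `T` and `C`: their intersection contains `C - x`, which already has the rank
    -- of `C`.
    circ-closure : ∀ {C T U x} → Circ ρ C → x ∈ C → C - x ⊆ T → U ⊆ T ∪ C → ρ U ≤ ρ T
    circ-closure {C} {T} {U} {x} c x∈C C-x⊆T U⊆ =
      ≤-by 6 (λ u d t r k e → u :+ d ≼ t :+ r ⇒ r :+ con 1 ≼ k ⇒ k ≼ e :+ con 1 ⇒ e ≼ d ⇒ ⊢ u ≼ t)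
        (ρ U) (ρ (C - x)) (ρ T) (ρ C) (∣ C ∣) (∣ C - x ∣)
        (submod-⊆ R T C U⊆ (⊆-by 3 (λ c s t → c :─ s ≼ t ⇒ ⊢ c :─ s ≼ t :∩ c) C ⁅ x ⁆ T C-x⊆T))
        (dependent c) (card-delete-≤ C x) (delete c x∈C)

    -- A dependent set contains a circuit, and each element of the circuit is spanned by the others,
    -- so it is no coloop.
    coloops⇒indep : ∀ {X} → (∀ {x} → x ∈ X → ρ (X - x) + 1 ≤ ρ X) → Indep ρ X
    coloops⇒indep {X} h = ¬Dep⇒Indep {ρ = ρ} λ d →
      let C , C⊆X , c = dep⇒circ d
          x , x∈C = circ-nonempty c
      in 1+n≰n (≤-by 2 (λ d r → d :+ con 1 ≼ r ⇒ r ≼ d ⇒ ⊢ con 1 ≼ con 0) (ρ (X - x)) (ρ X)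
           (h (C⊆X x∈C))
           (circ-closure c x∈C
             (⊆-by 3 (λ a b s → a ≼ b ⇒ ⊢ a :─ s ≼ b :─ s) C X ⁅ x ⁆ C⊆X)
             (⊆-by 3 (λ a b s → s ≼ a ⇒ ⊢ b ≼ (b :─ s) :∪ a) C X ⁅ x ⁆ (⁅⁆⊆ x∈C))))

    ⫽-≤ : ∀ B X → (ρ ⫽ B) X + ρ B ≤ ρ (X ∪ B)
    ⫽-≤ B X = ≤-reflexive (m∸n+n≡m (mono R (q⊆p∪q X B)))

    ⫽-≥ : ∀ B X → ρ (X ∪ B) ≤ (ρ ⫽ B) X + ρ B
    ⫽-≥ B X = ≤-reflexive (sym (m∸n+n≡m (mono R (q⊆p∪q X B))))

    ⫽-isRank : ∀ B → IsRank (ρ ⫽ B)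
    ⫽-isRank B .bound X =
      ≤-by 6 (λ c rb u rx x i → c :+ rb ≼ u ⇒ u :+ i ≼ rx :+ rb ⇒ rx ≼ x ⇒ ⊢ c ≼ x)
        ((ρ ⫽ B) X) (ρ B) (ρ (X ∪ B)) (ρ X) (∣ X ∣) (ρ (X ∩ B))
        (⫽-≤ B X) (submod R X B) (bound R X)
    ⫽-isRank B .mono {X} {Y} X⊆Y = ∸-monoˡ-≤ (ρ B)
      (mono R (⊆-by 3 (λ x y b → x ≼ y ⇒ ⊢ x :∪ b ≼ y :∪ b) X Y B X⊆Y))
    ⫽-isRank B .submod X Y =
      ≤-by 9 (λ cu ci cx cy u i x y b →
          cu :+ b ≼ u ⇒ ci :+ b ≼ i ⇒ x ≼ cx :+ b ⇒ y ≼ cy :+ b ⇒ u :+ i ≼ x :+ y ⇒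
          ⊢ cu :+ ci ≼ cx :+ cy)
        ((ρ ⫽ B) (X ∪ Y)) ((ρ ⫽ B) (X ∩ Y)) ((ρ ⫽ B) X) ((ρ ⫽ B) Y)
        (ρ ((X ∪ Y) ∪ B)) (ρ ((X ∩ Y) ∪ B)) (ρ (X ∪ B)) (ρ (Y ∪ B)) (ρ B)
        (⫽-≤ B _) (⫽-≤ B _) (⫽-≥ B X) (⫽-≥ B Y)
        (submod-⊆ R (X ∪ B) (Y ∪ B)
          (⊆-by 3 (λ x y b → ⊢ (x :∪ y) :∪ b ≼ (x :∪ b) :∪ (y :∪ b)) X Y B)
          (⊆-by 3 (λ x y b → ⊢ (x :∩ y) :∪ b ≼ (x :∪ b) :∩ (y :∪ b)) X Y B))

    contract-indep : ∀ {A B} → Indep (ρ ⫽ B) A → ∣ A ∣ + ρ B ≤ ρ (A ∪ B)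
    contract-indep {A} {B} i = ≤-trans (+-monoˡ-≤ (ρ B) i) (⫽-≤ B A)

    indep-contract : ∀ {A B} → ∣ A ∣ + ρ B ≤ ρ (A ∪ B) → Indep (ρ ⫽ B) A
    indep-contract {A} {B} h = +-cancelʳ-≤ (ρ B) _ _ (≤-trans h (⫽-≥ B A))

    -- Independent over `B`, the set `A` is also independent over the smaller `B′`, by submodularity
    -- of `A ∪ B′` and `B`; this adds up with the independence of `B′`.
    ∪-indep : ∀ {A B B′ X} → Indep (ρ ⫽ B) A → B′ ⊆ B → Indep ρ B′ → X ⊆ A ∪ B′ → Indep ρ X
    ∪-indep {A} {B} {B′} iA B′⊆B iB′ X⊆ = indep-⊆ X⊆
      (≤-by 7 (λ a rb ab ab′ rb′ b′ u →
          a :+ rb ≼ ab ⇒ ab :+ rb′ ≼ ab′ :+ rb ⇒ b′ ≼ rb′ ⇒ u ≼ a :+ b′ ⇒ ⊢ u ≼ ab′)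
        (∣ A ∣) (ρ B) (ρ (A ∪ B)) (ρ (A ∪ B′)) (ρ B′) (∣ B′ ∣) (∣ A ∪ B′ ∣)
        (contract-indep iA)
        (submod-⊆ R (A ∪ B′) B
          (⊆-by 3 (λ a b b′ → ⊢ a :∪ b ≼ (a :∪ b′) :∪ b) A B B′)
          (⊆-by 3 (λ a b b′ → b′ ≼ b ⇒ ⊢ b′ ≼ (a :∪ b′) :∩ b) A B B′ B′⊆B))
        iB′ (card-cover A B′ id))

    -- Deleting an element of `A` leaves a set independent over `B`, so the last hypothesis only has
    -- to cover deletions in `B`.
    ∪-circ : ∀ {A B} → Circ (ρ ⫽ B) A → A ∩ B ⊆ ⊥ → Indep ρ B →
             (∀ {b} → b ∈ B → Indep ρ (A ∪ (B - b))) → Circ ρ (A ∪ B)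
    ∪-circ {A} {B} c dis iB h = circ
      (≤-by 6 (λ u c rb a b ab →
          u ≼ c :+ rb ⇒ c :+ con 1 ≼ a ⇒ rb ≼ b ⇒ a :+ b ≼ ab ⇒ ⊢ u :+ con 1 ≼ ab)
        (ρ (A ∪ B)) ((ρ ⫽ B) A) (ρ B) (∣ A ∣) (∣ B ∣) (∣ A ∪ B ∣)
        (⫽-≥ B A) (dependent c) (bound R B) (card-disjoint A B dis id))
      λ {x} x∈ → case x∈p∪q⁻ A B x∈ of λ where
        (inj₁ x∈A) → ∪-indep (delete c x∈A) id iB
          (⊆-by 3 (λ a b s → ⊢ (a :∪ b) :─ s ≼ (a :─ s) :∪ b) A B ⁅ x ⁆)
        (inj₂ x∈B) → indep-⊆
          (⊆-by 3 (λ a b s → ⊢ (a :∪ b) :─ s ≼ a :∪ (b :─ s)) A B ⁅ x ⁆) (h x∈B)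

    -- Coloop-free sets of nullity 2, and fundamental circuits.

    nullity≥2⇒dep-delete : ∀ {C} → ρ C + 2 ≤ ∣ C ∣ → ∀ x → Dep ρ (C - x)
    nullity≥2⇒dep-delete {C} nullity≥2 x = ≤-by 4
      (λ r k d e → r :+ con 2 ≼ k ⇒ k ≼ d :+ con 1 ⇒ e ≼ r ⇒ ⊢ e :+ con 1 ≼ d)
      (ρ C) (∣ C ∣) (∣ C - x ∣) (ρ (C - x))
      nullity≥2 (card-delete-≤ C x) (mono R (p─q⊆p C ⁅ x ⁆))

    -- If the two circuits missed z, their union, of nullity 2, would lie in C - z, of nullity 1.
    circuits-cover : ∀ {C D₁ D₂} → (∀ {x} → x ∈ C → ∣ C ∣ ≤ ρ (C - x) + 2) →
                     D₁ ⊆ C → Circ ρ D₁ → D₂ ⊆ C → Circ ρ D₂ → Indep ρ (D₁ ∩ D₂) → C ⊆ D₁ ∪ D₂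
    circuits-cover {C} {D₁} {D₂} nullity-del D₁⊆C c₁ D₂⊆C c₂ i {z} z∈C =
      decidable-stable (z ∈? D₁ ∪ D₂) λ z∉ →
      1+n≰n (≤-by 11 (λ rz u ru cz ri r₁ r₂ d₁ d₂ i c →
          rz :+ u ≼ ru :+ cz ⇒ ru :+ ri ≼ r₁ :+ r₂ ⇒ r₁ :+ con 1 ≼ d₁ ⇒ r₂ :+ con 1 ≼ d₂ ⇒
          i ≼ ri ⇒ d₁ :+ d₂ ≼ u :+ i ⇒ c ≼ rz :+ con 2 ⇒ cz :+ con 1 ≼ c ⇒ ⊢ con 1 ≼ con 0)
        (ρ (C - z)) (∣ D₁ ∪ D₂ ∣) (ρ (D₁ ∪ D₂)) (∣ C - z ∣) (ρ (D₁ ∩ D₂)) (ρ D₁) (ρ D₂)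
        (∣ D₁ ∣) (∣ D₂ ∣) (∣ D₁ ∩ D₂ ∣) (∣ C ∣)
        (nullity-mono (⊆-delete (⊆-by 3 (λ a b c → a ≼ c ⇒ b ≼ c ⇒ ⊢ a :∪ b ≼ c) D₁ D₂ C D₁⊆C D₂⊆C) z∉))
        (submod R D₁ D₂) (dependent c₁) (dependent c₂) i
        (≤-reflexive (sym (∣∪∣+∣∩∣ D₁ D₂))) (nullity-del z∈C) (card-delete-≥ z∈C))

    -- Because `D₂` avoids an element of `D₁`, the intersection is a proper subset of a circuit,
    -- hence independent, as `circuits-cover` requires.
    avoiding-circuits : ∀ {C D₁ D₂ x y} → (∀ {x} → x ∈ C → ∣ C ∣ ≤ ρ (C - x) + 2) →
      x ∈ C → D₁ ⊆ C - x → Circ ρ D₁ → y ∈ D₁ → D₂ ⊆ C - y → Circ ρ D₂ →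
      (D₁ ⊂ C × Circ ρ D₁) × (D₂ ⊂ C × Circ ρ D₂) × C ⊆ D₁ ∪ D₂
    avoiding-circuits {C} {D₁} {D₂} {x} {y} nullity-del x∈C D₁⊆ c₁ y∈D₁ D₂⊆ c₂ =
         ((D₁⊆C , x , x∈C , λ x∈D₁ → ∉-delete C x (D₁⊆ x∈D₁)) , c₁) ,
         ((D₂⊆C , y , D₁⊆C y∈D₁ , y∉D₂) , c₂) ,
         circuits-cover nullity-del D₁⊆C c₁ D₂⊆C c₂
           (circ-⊂ c₁ (p∩q⊆p D₁ D₂ , y , y∈D₁ , λ y∈ → y∉D₂ (p∩q⊆q D₁ D₂ y∈)))
      where
      D₁⊆C : D₁ ⊆ C
      D₁⊆C z∈ = p─q⊆p C ⁅ x ⁆ (D₁⊆ z∈)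
      D₂⊆C : D₂ ⊆ C
      D₂⊆C z∈ = p─q⊆p C ⁅ y ⁆ (D₂⊆ z∈)
      y∉D₂ : y ∉ D₂
      y∉D₂ y∈D₂ = ∉-delete C y (D₂⊆ y∈D₂)

    -- The second hypothesis bounds the nullity of every `C - x` by 1, so `C` has nullity exactly 2
    -- and no coloops. Each `C - x` is still dependent, which yields a circuit avoiding any chosen
    -- element.
    two-circuits : ∀ {C} → ρ C + 2 ≤ ∣ C ∣ → (∀ {x} → x ∈ C → ∣ C ∣ ≤ ρ (C - x) + 2) →
                   ∃ λ D₁ → ∃ λ D₂ → (D₁ ⊂ C × Circ ρ D₁) × (D₂ ⊂ C × Circ ρ D₂) × C ⊆ D₁ ∪ D₂
    two-circuits {C} nullity≥2 nullity-del =
      case 0<card⇒nonempty C 0<C of λ where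
        (x , x∈C) → case dep⇒circ (nullity≥2⇒dep-delete nullity≥2 x) of λ where
          (D₁ , D₁⊆ , c₁) → case circ-nonempty c₁ of λ where
            (y , y∈D₁) → case dep⇒circ (nullity≥2⇒dep-delete nullity≥2 y) of λ where
              (D₂ , D₂⊆ , c₂) → D₁ , D₂ , avoiding-circuits nullity-del x∈C D₁⊆ c₁ y∈D₁ D₂⊆ c₂
      where
      0<C : 0 < ∣ C ∣
      0<C = ≤-by 2 (λ r k → r :+ con 2 ≼ k ⇒ ⊢ con 1 ≼ k) (ρ C) (∣ C ∣) nullity≥2

    large-circuit : ∀ {C} → ρ C + 2 ≤ ∣ C ∣ → (∀ {x} → x ∈ C → ∣ C ∣ ≤ ρ (C - x) + 2) →
                    ∃ λ D → (D ⊂ C × Circ ρ D) × ∣ C ∣ ≤ ∣ D ∣ + ∣ D ∣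
    large-circuit {C} h₂ h₁ = case two-circuits {C} h₂ h₁ of λ where
      (D₁ , D₂ , d₁ , d₂ , cov) → case ∣ D₁ ∣ ≤? ∣ D₂ ∣ of λ where
        (yes le) → D₂ , d₂ , ≤-by 3 (λ c a b → c ≼ a :+ b ⇒ a ≼ b ⇒ ⊢ c ≼ b :+ b)
                     (∣ C ∣) (∣ D₁ ∣) (∣ D₂ ∣) (card-cover D₁ D₂ cov) le
        (no  gt) → D₁ , d₁ , ≤-by 3 (λ c a b → c ≼ a :+ b ⇒ b ≼ a ⇒ ⊢ c ≼ a :+ a)
                     (∣ C ∣) (∣ D₁ ∣) (∣ D₂ ∣) (card-cover D₁ D₂ cov) (<⇒≤ (≰⇒> gt))

    circuit-through : ∀ {C e} → ρ C + 2 ≤ ∣ C ∣ → (∀ {x} → x ∈ C → ∣ C ∣ ≤ ρ (C - x) + 2) →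
                      e ∈ C → ∃ λ D → (D ⊂ C × Circ ρ D) × e ∈ D
    circuit-through {C} h₂ h₁ e∈C = case two-circuits {C} h₂ h₁ of λ where
      (D₁ , D₂ , d₁ , d₂ , cov) → case x∈p∪q⁻ D₁ D₂ (cov e∈C) of λ where
        (inj₁ e∈D₁) → D₁ , d₁ , e∈D₁
        (inj₂ e∈D₂) → D₂ , d₂ , e∈D₂

    -- `Y` is a minimal subset of `X` spanning `g`. Removing `y` loses `g` from the span, so the
    -- rank drops: every `y` is a coloop of `Y`, and `Y` is independent.
    fundamental-circuit : ∀ {X g} → g ∉ X → ρ (X ∪ ⁅ g ⁆) ≤ ρ X →
                          ∃ λ D → Circ ρ D × g ∈ D × D ⊆ X ∪ ⁅ g ⁆
    fundamental-circuit {X} {g} g∉X spans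
      with minimal-subset (λ Y → ρ (Y ∪ ⁅ g ⁆) ≤? ρ Y) X spans
    ... | Y , Y⊆X , spansY , minY = Y ∪ ⁅ g ⁆ , circ
        (≤-by 4 (λ u r y v → u ≼ r ⇒ r ≼ y ⇒ y :+ con 1 ≼ v ⇒ ⊢ u :+ con 1 ≼ v)
          (ρ (Y ∪ ⁅ g ⁆)) (ρ Y) (∣ Y ∣) (∣ Y ∪ ⁅ g ⁆ ∣)
          spansY (bound R Y)
          (subst (λ k → ∣ Y ∣ + k ≤ ∣ Y ∪ ⁅ g ⁆ ∣) (∣⁅x⁆∣≡1 g)
            (card-disjoint Y ⁅ g ⁆ (⊆-by 3 (λ x y s → y ≼ x ⇒ s :∩ x ≼ ∅ ⇒ ⊢ y :∩ s ≼ ∅)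
               X Y ⁅ g ⁆ Y⊆X (∉⇒disjoint g∉X)) id)))
        deleted ,
      x∈p∪q⁺ (inj₂ (x∈⁅x⁆ g)) ,
      ⊆-by 3 (λ x y s → y ≼ x ⇒ ⊢ y :∪ s ≼ x :∪ s) X Y ⁅ g ⁆ Y⊆X
      where
      jump : ∀ {y} → y ∈ Y → ρ (Y - y) + 1 ≤ ρ ((Y - y) ∪ ⁅ g ⁆)
      jump {y} y∈Y = subst (_≤ ρ ((Y - y) ∪ ⁅ g ⁆)) (+-comm 1 (ρ (Y - y))) (≰⇒> (minY y∈Y))
      coloop : ∀ {y} → y ∈ Y → ρ (Y - y) + 1 ≤ ρ Y
      coloop {y} y∈Y = ≤-trans (jump y∈Y) (≤-trans
        (mono R (⊆-by 3 (λ y s t → ⊢ (y :─ s) :∪ t ≼ y :∪ t) Y ⁅ y ⁆ ⁅ g ⁆)) spansY)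
      indepY : Indep ρ Y
      indepY = coloops⇒indep coloop
      deleted : ∀ {x} → x ∈ Y ∪ ⁅ g ⁆ → Indep ρ ((Y ∪ ⁅ g ⁆) - x)
      deleted {x} x∈ with x∈p∪q⁻ Y ⁅ g ⁆ x∈
      ... | inj₂ x∈g rewrite x∈⁅y⁆⇒x≡y g x∈g =
            indep-⊆ (⊆-by 2 (λ y s → ⊢ (y :∪ s) :─ s ≼ y) Y ⁅ g ⁆) indepY
      ... | inj₁ x∈Y = indep-⊆
            (⊆-by 3 (λ y s t → ⊢ (y :∪ t) :─ s ≼ (y :─ s) :∪ t) Y ⁅ x ⁆ ⁅ g ⁆)
            (≤-by 5 (λ u d g r j → u ≼ d :+ g ⇒ g ≼ con 1 ⇒ d ≼ r ⇒ r :+ con 1 ≼ j ⇒ ⊢ u ≼ j)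
              (∣ (Y - x) ∪ ⁅ g ⁆ ∣) (∣ Y - x ∣) (∣ ⁅ g ⁆ ∣) (ρ (Y - x)) (ρ ((Y - x) ∪ ⁅ g ⁆))
              (card-cover (Y - x) ⁅ g ⁆ id) (≤-reflexive (∣⁅x⁆∣≡1 g))
              (indep-⊆ (p─q⊆p Y ⁅ x ⁆) indepY) (jump x∈Y))

abstract

  card-submod : ∀ {n} {U I : Subset n} X Y → U ⊆ X ∪ Y → I ⊆ X ∩ Y → ∣ U ∣ + ∣ I ∣ ≤ ∣ X ∣ + ∣ Y ∣
  card-submod X Y U⊆ I⊆ = ≤-trans (+-mono-≤ (p⊆q⇒∣p∣≤∣q∣ U⊆) (p⊆q⇒∣p∣≤∣q∣ I⊆))
                                  (≤-reflexive (∣∪∣+∣∩∣ X Y))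

  ¬+1≤⇒≥ : ∀ {m n} → ¬ (m + 1 ≤ n) → n ≤ m
  ¬+1≤⇒≥ {m} {n} h = decidable-stable (n ≤? m) λ n≰m → h (subst (_≤ n) (+-comm 1 m) (≰⇒> n≰m))

-- Circuits extending a circuit of a contraction.

module _ {n : ℕ} {ρ : Subset n → ℕ} (R : IsRank ρ) where

  abstract

    rank-∪ : ∀ {U} X Y → U ⊆ X ∪ Y → ρ U ≤ ∣ X ∣ + ρ Y
    rank-∪ X Y U⊆ = ≤-trans (mono R U⊆)
      (≤-trans (⫽-≥ R Y X) (+-monoˡ-≤ (ρ Y) (bound (⫽-isRank R Y) X)))

    indep-⊥ : Indep ρ ⊥
    indep-⊥ = ≤-trans (≤-reflexive (∣⊥∣≡0 n)) z≤n

    -- The rank of `C ∪ D` is two less than its size while `D` is independent, so `C` has nullity 2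
    -- over `D` and `e` lies in a circuit `D₁` over `D` properly inside `C`. Then `D₁ ∪ D` is a
    -- circuit: `D - b` is independent over `C`, and `D₁` is independent.
    extend-circuit : ∀ {C D e} → Circ ρ C → Circ (ρ ⫽ C) D → D ∩ C ⊆ ⊥ → Indep ρ D → e ∈ C →
                     ∃ λ X → Circ ρ X × e ∈ X × D ⊆ X × X ⊆ C ∪ D
    extend-circuit {C} {D} {e} cC cD D∩C⊆⊥ iD e∈C =
      case circuit-through (⫽-isRank R D) {C} nullity≥2 nullity-del e∈C of λ where
        (D₁ , (D₁⊂C , c₁) , e∈D₁) → extend D₁⊂C c₁ e∈D₁
      where
      extend : ∀ {D₁} → D₁ ⊂ C → Circ (ρ ⫽ D) D₁ → e ∈ D₁ →
               ∃ λ X → Circ ρ X × e ∈ X × D ⊆ X × X ⊆ C ∪ D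
      extend {D₁} (D₁⊆C , ex) c₁ e∈D₁ = D₁ ∪ D ,
        ∪-circ R c₁
          (⊆-by 3 (λ c d d₁ → d₁ ≼ c ⇒ d :∩ c ≼ ∅ ⇒ ⊢ d₁ :∩ d ≼ ∅) C D D₁ D₁⊆C D∩C⊆⊥)
          iD
          (λ {b} b∈D → ∪-indep R (delete cD b∈D) D₁⊆C (circ-⊂ R cC (D₁⊆C , ex))
            (⊆-by 2 (λ x y → ⊢ x :∪ y ≼ y :∪ x) D₁ (D - b))) ,
        x∈p∪q⁺ (inj₁ e∈D₁) ,
        q⊆p∪q D₁ D ,
        ⊆-by 3 (λ c d d₁ → d₁ ≼ c ⇒ ⊢ d₁ :∪ d ≼ c :∪ d) C D D₁ D₁⊆C
      nullity≥2 : (ρ ⫽ D) C + 2 ≤ ∣ C ∣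
      nullity≥2 = ≤-by 8 (λ f rd u v g rc d c →
          f :+ rd ≼ u ⇒ u ≼ v ⇒ v ≼ g :+ rc ⇒ g :+ con 1 ≼ d ⇒ rc :+ con 1 ≼ c ⇒ d ≼ rd ⇒
          ⊢ f :+ con 2 ≼ c)
        ((ρ ⫽ D) C) (ρ D) (ρ (C ∪ D)) (ρ (D ∪ C)) ((ρ ⫽ C) D) (ρ C) (∣ D ∣) (∣ C ∣)
        (⫽-≤ R D C) (mono R (⊆-by 2 (λ x y → ⊢ x :∪ y ≼ y :∪ x) C D)) (⫽-≥ R C D)
        (dependent cD) (dependent cC) iD
      nullity-del : ∀ {x} → x ∈ C → ∣ C ∣ ≤ (ρ ⫽ D) (C - x) + 2
      nullity-del {x} x∈C = ≤-by 8 (λ f rd u v g rc d c →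
          u ≼ f :+ rd ⇒ rd ≼ d ⇒ v ≼ u ⇒ g :+ rc ≼ v ⇒ d ≼ g :+ con 1 ⇒ c ≼ rc :+ con 1 ⇒
          ⊢ c ≼ f :+ con 2)
        ((ρ ⫽ D) (C - x)) (ρ D) (ρ ((C - x) ∪ D)) (ρ (D ∪ C)) ((ρ ⫽ C) D) (ρ C) (∣ D ∣) (∣ C ∣)
        (⫽-≥ R D (C - x)) (bound R D)
        (circ-closure R cC x∈C (p⊆p∪q D)
          (⊆-by 3 (λ c d s → ⊢ d :∪ c ≼ ((c :─ s) :∪ d) :∪ c) C D ⁅ x ⁆))
        (⫽-≤ R C D) (circ-rank (⫽-isRank R C) cD) (circ-rank R cC)

    -- If `g` is outside `C₁`, it lies in a circuit `D` over `C₁` inside `C₂ ─ C₁`. This `D` misses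
    -- `f`, so it is independent as a proper subset of `C₂`, and `extend-circuit` joins it to `e`.
    circuits-transitive : ∀ {C₁ C₂ e f g} → Circ ρ C₁ → e ∈ C₁ → f ∈ C₁ → Circ ρ C₂ → f ∈ C₂ → g ∈ C₂ →
                          ∃ λ X → Circ ρ X × e ∈ X × g ∈ X × X ⊆ C₁ ∪ C₂
    circuits-transitive {C₁} {C₂} {e} {f} {g} c₁ e∈C₁ f∈C₁ c₂ f∈C₂ g∈C₂ = case g ∈? C₁ of λ where
        (yes g∈C₁) → C₁ , c₁ , e∈C₁ , g∈C₁ , λ {x} → p⊆p∪q C₂ {x}
        (no  g∉C₁) → case fundamental-circuit (⫽-isRank R C₁) {C₂ ─ C₁ - g} (∉-delete (C₂ ─ C₁) g) spans of λ where
          (D , cD , g∈D , D⊆) → through g∉C₁ cD g∈D D⊆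
      where
      through : g ∉ C₁ → ∀ {D} → Circ (ρ ⫽ C₁) D → g ∈ D → D ⊆ (C₂ ─ C₁ - g) ∪ ⁅ g ⁆ →
                ∃ λ X → Circ ρ X × e ∈ X × g ∈ X × X ⊆ C₁ ∪ C₂
      through g∉C₁ {D} cD g∈D D⊆ =
        case extend-circuit c₁ cD D∩C₁⊆⊥ (circ-⊂ R c₂ (D⊆C₂ , f , f∈C₂ , f∉D)) e∈C₁ of λ where
          (X , cX , e∈X , D⊆X , X⊆) → X , cX , e∈X , D⊆X g∈D , λ {x} →
            ⊆-by 4 (λ a b d x → d ≼ b ⇒ x ≼ a :∪ d ⇒ ⊢ x ≼ a :∪ b) C₁ C₂ D X D⊆C₂ X⊆ {x}
        where
        D⊆C₂ : D ⊆ C₂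
        D⊆C₂ = ⊆-by 4 (λ a b s d → d ≼ ((b :─ a) :─ s) :∪ s ⇒ s ≼ b ⇒ ⊢ d ≼ b)
          C₁ C₂ ⁅ g ⁆ D D⊆ (⁅⁆⊆ g∈C₂)
        D∩C₁⊆⊥ : D ∩ C₁ ⊆ ⊥
        D∩C₁⊆⊥ = ⊆-by 4 (λ a b s d → d ≼ ((b :─ a) :─ s) :∪ s ⇒ s :∩ a ≼ ∅ ⇒ ⊢ d :∩ a ≼ ∅)
          C₁ C₂ ⁅ g ⁆ D D⊆ (∉⇒disjoint g∉C₁)
        f∉D : f ∉ D
        f∉D f∈D = ∉⊥ (D∩C₁⊆⊥ (x∈p∩q⁺ (f∈D , f∈C₁)))
      spans : (ρ ⫽ C₁) ((C₂ ─ C₁ - g) ∪ ⁅ g ⁆) ≤ (ρ ⫽ C₁) (C₂ ─ C₁ - g)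
      spans = ∸-monoˡ-≤ (ρ C₁) (circ-closure R c₂ g∈C₂
        (⊆-by 3 (λ a b s → ⊢ b :─ s ≼ ((b :─ a) :─ s) :∪ a) C₁ C₂ ⁅ g ⁆)
        (⊆-by 3 (λ a b s → s ≼ b ⇒ ⊢ (((b :─ a) :─ s) :∪ s) :∪ a ≼ (((b :─ a) :─ s) :∪ a) :∪ b)
          C₁ C₂ ⁅ g ⁆ (⁅⁆⊆ g∈C₂)))

-- The local connectivity of C and D in ρ ⫽ A is positive; cardinalities are moved so that no
-- subtraction occurs.
Linked : ∀ {n} → (Subset n → ℕ) → Subset n → Subset n → Subset n → Set
Linked ρ C D A = ρ A + ρ (A ∪ (C ∪ D)) + 1 ≤ ρ (A ∪ C) + ρ (A ∪ D)

-- Gluing two circuits along a minimal linking set.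

module MinimalLink {n : ℕ} {ρ : Subset n → ℕ} (R : IsRank ρ) {C D A : Subset n}
  (cC : Circ ρ C) (cD : Circ ρ D) (C∩D⊆⊥ : C ∩ D ⊆ ⊥) (A∩⊆⊥ : A ∩ (C ∪ D) ⊆ ⊥)
  (linked : Linked ρ C D A) (minimal : ∀ {a} → a ∈ A → ¬ Linked ρ C D (A - a)) where

  abstract

    unlinked : ∀ {a} → a ∈ A → ρ ((A - a) ∪ C) + ρ ((A - a) ∪ D) ≤ ρ (A - a) + ρ ((A - a) ∪ (C ∪ D))
    unlinked a∈A = ¬+1≤⇒≥ (minimal a∈A)

    U-mono : ∀ {a} → ρ ((A - a) ∪ (C ∪ D)) ≤ ρ (A ∪ (C ∪ D))
    U-mono {a} = mono R (⊆-by 3 (λ a s u → ⊢ (a :─ s) :∪ u ≼ a :∪ u) A ⁅ a ⁆ (C ∪ D))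

    diminishing : ∀ {a} X → ρ (A ∪ X) + ρ (A - a) ≤ ρ A + ρ ((A - a) ∪ X)
    diminishing {a} X = submod-⊆ R A ((A - a) ∪ X)
      (⊆-by 3 (λ a s x → ⊢ a :∪ x ≼ a :∪ ((a :─ s) :∪ x)) A ⁅ a ⁆ X)
      (⊆-by 3 (λ a s x → ⊢ a :─ s ≼ a :∩ ((a :─ s) :∪ x)) A ⁅ a ⁆ X)

    -- Adding `a` makes the local connectivity positive. By `diminishing`, the rank of `A ∪ D` grows
    -- no more than that of `A`, so the growth must come from the side of `C`.
    jump-C : ∀ {a} → a ∈ A → ρ ((A - a) ∪ C) + 1 ≤ ρ (A ∪ C)
    jump-C {a} a∈A = ≤-by 8 (λ rA U AC AD rA′ U′ AC′ AD′ →
        rA :+ U :+ con 1 ≼ AC :+ AD ⇒ AC′ :+ AD′ ≼ rA′ :+ U′ ⇒ U′ ≼ U ⇒ AD :+ rA′ ≼ rA :+ AD′ ⇒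
        ⊢ AC′ :+ con 1 ≼ AC)
      (ρ A) (ρ (A ∪ (C ∪ D))) (ρ (A ∪ C)) (ρ (A ∪ D))
      (ρ (A - a)) (ρ ((A - a) ∪ (C ∪ D))) (ρ ((A - a) ∪ C)) (ρ ((A - a) ∪ D))
      linked (unlinked a∈A) U-mono (diminishing D)

    jump-D : ∀ {a} → a ∈ A → ρ ((A - a) ∪ D) + 1 ≤ ρ (A ∪ D)
    jump-D {a} a∈A = ≤-by 8 (λ rA U AC AD rA′ U′ AC′ AD′ →
        rA :+ U :+ con 1 ≼ AC :+ AD ⇒ AC′ :+ AD′ ≼ rA′ :+ U′ ⇒ U′ ≼ U ⇒ AC :+ rA′ ≼ rA :+ AC′ ⇒
        ⊢ AD′ :+ con 1 ≼ AD)
      (ρ A) (ρ (A ∪ (C ∪ D))) (ρ (A ∪ C)) (ρ (A ∪ D))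
      (ρ (A - a)) (ρ ((A - a) ∪ (C ∪ D))) (ρ ((A - a) ∪ C)) (ρ ((A - a) ∪ D))
      linked (unlinked a∈A) U-mono (diminishing C)

    jump⇒indep : ∀ {X} → (∀ {a} → a ∈ A → ρ ((A - a) ∪ X) + 1 ≤ ρ (A ∪ X)) → Indep (ρ ⫽ X) A
    jump⇒indep {X} jump = coloops⇒indep (⫽-isRank R X) λ {a} a∈A →
      ≤-by 5 (λ f g u v r → f :+ r ≼ u ⇒ u :+ con 1 ≼ v ⇒ v ≼ g :+ r ⇒ ⊢ f :+ con 1 ≼ g)
        ((ρ ⫽ X) (A - a)) ((ρ ⫽ X) A) (ρ ((A - a) ∪ X)) (ρ (A ∪ X)) (ρ X)
        (⫽-≤ R X (A - a)) (jump a∈A) (⫽-≥ R X A)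

    A-indep/C : Indep (ρ ⫽ C) A
    A-indep/C = jump⇒indep jump-C

    A-indep/D : Indep (ρ ⫽ D) A
    A-indep/D = jump⇒indep jump-D

    A-indep : Indep ρ A
    A-indep = ∪-indep R A-indep/C (⊆-min C) (indep-⊥ R) (p⊆p∪q ⊥)

    -- Over `A - a` the connectivity is at most 0. Adding `a` raises the two ranks on the left by at
    -- most 1 each, and raises the rank of the independent set `A` by 1.
    linked-once : ∀ {a} → a ∈ A → ρ (A ∪ C) + ρ (A ∪ D) ≤ ρ A + ρ (A ∪ (C ∪ D)) + 1
    linked-once {a} a∈A = ≤-by 10 (λ rA U AC AD rA′ U′ AC′ AD′ A A′ →
        AC ≼ con 1 :+ AC′ ⇒ AD ≼ con 1 :+ AD′ ⇒ AC′ :+ AD′ ≼ rA′ :+ U′ ⇒ U′ ≼ U ⇒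
        rA′ ≼ A′ ⇒ A′ :+ con 1 ≼ A ⇒ A ≼ rA ⇒ ⊢ AC :+ AD ≼ rA :+ U :+ con 1)
      (ρ A) (ρ (A ∪ (C ∪ D))) (ρ (A ∪ C)) (ρ (A ∪ D))
      (ρ (A - a)) (ρ ((A - a) ∪ (C ∪ D))) (ρ ((A - a) ∪ C)) (ρ ((A - a) ∪ D)) (∣ A ∣) (∣ A - a ∣)
      (step C) (step D) (unlinked a∈A) U-mono (bound R (A - a)) (card-delete-≥ a∈A) A-indep
      where
      step : ∀ X → ρ (A ∪ X) ≤ 1 + ρ ((A - a) ∪ X)
      step X = subst (λ k → ρ (A ∪ X) ≤ k + ρ ((A - a) ∪ X)) (∣⁅x⁆∣≡1 a)
        (rank-∪ R ⁅ a ⁆ ((A - a) ∪ X)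
          (⊆-by 3 (λ a s x → ⊢ a :∪ x ≼ s :∪ ((a :─ s) :∪ x)) A ⁅ a ⁆ X))

    -- Over `A ∪ D` the rank of `C` is two below its size: one because `C` is a circuit, one because
    -- its connectivity with `D` over `A` is 1.
    half-of-C : ∀ {a} → a ∈ A → ∃ λ C₁ → (C₁ ⊂ C × Circ (ρ ⫽ (A ∪ D)) C₁) × ∣ C ∣ ≤ ∣ C₁ ∣ + ∣ C₁ ∣
    half-of-C a∈A = large-circuit (⫽-isRank R (A ∪ D)) {C}
      (≤-by 9 (λ f AD CAD U rA AC A rC C →
          f :+ AD ≼ CAD ⇒ CAD ≼ U ⇒ rA :+ U :+ con 1 ≼ AC :+ AD ⇒ AC ≼ A :+ rC ⇒ A ≼ rA ⇒
          rC :+ con 1 ≼ C ⇒ ⊢ f :+ con 2 ≼ C)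
        ((ρ ⫽ (A ∪ D)) C) (ρ (A ∪ D)) (ρ (C ∪ (A ∪ D))) (ρ (A ∪ (C ∪ D))) (ρ A) (ρ (A ∪ C))
        (∣ A ∣) (ρ C) (∣ C ∣)
        (⫽-≤ R (A ∪ D) C) (mono R (⊆-by 3 (λ a c d → ⊢ c :∪ (a :∪ d) ≼ a :∪ (c :∪ d)) A C D))
        linked (rank-∪ R A C id) A-indep (dependent cC))
      λ {x} x∈C → ≤-by 9 (λ f AD XAD U rA AC A rC C →
          XAD ≼ f :+ AD ⇒ U ≼ XAD ⇒ AC :+ AD ≼ rA :+ U :+ con 1 ⇒ rA ≼ A ⇒ A :+ rC ≼ AC ⇒
          C ≼ rC :+ con 1 ⇒ ⊢ C ≼ f :+ con 2)
        ((ρ ⫽ (A ∪ D)) (C - x)) (ρ (A ∪ D)) (ρ ((C - x) ∪ (A ∪ D))) (ρ (A ∪ (C ∪ D))) (ρ A) (ρ (A ∪ C))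
        (∣ A ∣) (ρ C) (∣ C ∣)
        (⫽-≥ R (A ∪ D) (C - x))
        (circ-closure R cC x∈C (p⊆p∪q (A ∪ D))
          (⊆-by 4 (λ a c d s → ⊢ a :∪ (c :∪ d) ≼ ((c :─ s) :∪ (a :∪ d)) :∪ c) A C D ⁅ x ⁆))
        (linked-once a∈A) (bound R A) (contract-indep R A-indep/C) (circ-rank R cC)

  module _ {C₁ : Subset n} (C₁⊂C : C₁ ⊂ C) (c₁ : Circ (ρ ⫽ (A ∪ D)) C₁) where

    abstract

      C₁∪A-indep : Indep ρ (C₁ ∪ A)
      C₁∪A-indep = ∪-indep R A-indep/C (proj₁ C₁⊂C) (circ-⊂ R cC C₁⊂C)
        (⊆-by 2 (λ x y → ⊢ x :∪ y ≼ y :∪ x) C₁ A)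

      card-C₁∪A : ∣ C₁ ∣ + ∣ A ∣ ≤ ∣ C₁ ∪ A ∣
      card-C₁∪A = card-disjoint C₁ A
        (⊆-by 4 (λ a c d c₁ → c₁ ≼ c ⇒ a :∩ (c :∪ d) ≼ ∅ ⇒ ⊢ c₁ :∩ a ≼ ∅) A C D C₁ (proj₁ C₁⊂C) A∩⊆⊥) id

      -- Over the independent set `C₁ ∪ A`, the nullity of `D` is 2: one from `D` being a circuit
      -- over `A`, one from `C₁` being independent over `A` but a circuit over `A ∪ D`.
      half-of-D : ∃ λ D₁ → (D₁ ⊂ D × Circ (ρ ⫽ (C₁ ∪ A)) D₁) × ∣ D ∣ ≤ ∣ D₁ ∣ + ∣ D₁ ∣
      half-of-D = large-circuit (⫽-isRank R (C₁ ∪ A)) {D}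
        (≤-by 11 (λ g B DB U f AD c₁ A rD D B# →
            g :+ B ≼ DB ⇒ DB ≼ U ⇒ U ≼ f :+ AD ⇒ f :+ con 1 ≼ c₁ ⇒ AD ≼ A :+ rD ⇒
            rD :+ con 1 ≼ D ⇒ c₁ :+ A ≼ B# ⇒ B# ≼ B ⇒ ⊢ g :+ con 2 ≼ D)
          ((ρ ⫽ (C₁ ∪ A)) D) (ρ (C₁ ∪ A)) (ρ (D ∪ (C₁ ∪ A))) (ρ (C₁ ∪ (A ∪ D)))
          ((ρ ⫽ (A ∪ D)) C₁) (ρ (A ∪ D)) (∣ C₁ ∣) (∣ A ∣) (ρ D) (∣ D ∣) (∣ C₁ ∪ A ∣)
          (⫽-≤ R (C₁ ∪ A) D)
          (mono R (⊆-by 3 (λ a c d → ⊢ d :∪ (c :∪ a) ≼ c :∪ (a :∪ d)) A C₁ D))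
          (⫽-≥ R (A ∪ D) C₁) (dependent c₁) (rank-∪ R A D id) (dependent cD)
          card-C₁∪A C₁∪A-indep)
        λ {y} y∈D → ≤-by 11 (λ g B YB U f AD c₁ A rD D B# →
            YB ≼ g :+ B ⇒ B ≼ B# ⇒ B# ≼ c₁ :+ A ⇒ U ≼ YB ⇒ f :+ AD ≼ U ⇒ c₁ ≼ f :+ con 1 ⇒
            A :+ rD ≼ AD ⇒ D ≼ rD :+ con 1 ⇒ ⊢ D ≼ g :+ con 2)
          ((ρ ⫽ (C₁ ∪ A)) (D - y)) (ρ (C₁ ∪ A)) (ρ ((D - y) ∪ (C₁ ∪ A))) (ρ (C₁ ∪ (A ∪ D)))
          ((ρ ⫽ (A ∪ D)) C₁) (ρ (A ∪ D)) (∣ C₁ ∣) (∣ A ∣) (ρ D) (∣ D ∣) (∣ C₁ ∪ A ∣)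
          (⫽-≥ R (C₁ ∪ A) (D - y)) (bound R (C₁ ∪ A)) (card-cover C₁ A id)
          (circ-closure R cD y∈D (p⊆p∪q (C₁ ∪ A))
            (⊆-by 4 (λ a c d s → ⊢ c :∪ (a :∪ d) ≼ ((d :─ s) :∪ (c :∪ a)) :∪ d) A C₁ D ⁅ y ⁆))
          (⫽-≤ R (A ∪ D) C₁) (circ-rank (⫽-isRank R (A ∪ D)) c₁)
          (contract-indep R A-indep/D) (circ-rank R cD)

    module _ {D₁ : Subset n} (D₁⊂D : D₁ ⊂ D) (d₁ : Circ (ρ ⫽ (C₁ ∪ A)) D₁) where

      abstract

        A∪D₁-indep : Indep ρ (A ∪ D₁)
        A∪D₁-indep = ∪-indep R A-indep/D (proj₁ D₁⊂D) (circ-⊂ R cD D₁⊂D) id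

        delete-C₁ : ∀ {b} → b ∈ C₁ → Indep ρ (D₁ ∪ ((C₁ ∪ A) - b))
        delete-C₁ {b} b∈C₁ = ∪-indep R (delete c₁ b∈C₁)
          (⊆-by 3 (λ a d d₁ → d₁ ≼ d ⇒ ⊢ a :∪ d₁ ≼ a :∪ d) A D D₁ (proj₁ D₁⊂D)) A∪D₁-indep
          (⊆-by 4 (λ a c d s → ⊢ d :∪ ((c :∪ a) :─ s) ≼ (c :─ s) :∪ (a :∪ d)) A C₁ D₁ ⁅ b ⁆)

        -- By minimality `C` and `D` are skew over `A - b`, so `C₁`, independent over `A - b`, stays
        -- independent when `D` is contracted as well.
        C₁-indep : ∀ {b} → b ∈ A → Indep (ρ ⫽ ((A - b) ∪ D)) C₁
        C₁-indep {b} b∈A = indep-contract R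
          (≤-by 9 (λ U CA AC V c₁ A′ rA′ AD CA# →
              U :+ CA ≼ AC :+ V ⇒ c₁ :+ A′ ≼ CA# ⇒ CA# ≼ CA ⇒ rA′ ≼ A′ ⇒ AC :+ AD ≼ rA′ :+ U ⇒
              ⊢ c₁ :+ AD ≼ V)
            (ρ ((A - b) ∪ (C ∪ D))) (ρ (C₁ ∪ (A - b))) (ρ ((A - b) ∪ C)) (ρ (C₁ ∪ ((A - b) ∪ D)))
            (∣ C₁ ∣) (∣ A - b ∣) (ρ (A - b)) (ρ ((A - b) ∪ D)) (∣ C₁ ∪ (A - b) ∣)
            (submod-⊆ R ((A - b) ∪ C) (C₁ ∪ ((A - b) ∪ D))
              (⊆-by 4 (λ a c d c₁ → ⊢ a :∪ (c :∪ d) ≼ (a :∪ c) :∪ (c₁ :∪ (a :∪ d))) (A - b) C D C₁)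
              (⊆-by 4 (λ a c d c₁ → c₁ ≼ c ⇒ ⊢ c₁ :∪ a ≼ (a :∪ c) :∩ (c₁ :∪ (a :∪ d)))
                (A - b) C D C₁ (proj₁ C₁⊂C)))
            (card-disjoint C₁ (A - b)
              (⊆-by 5 (λ a c d c₁ s → c₁ ≼ c ⇒ a :∩ (c :∪ d) ≼ ∅ ⇒ ⊢ c₁ :∩ (a :─ s) ≼ ∅)
                A C D C₁ ⁅ b ⁆ (proj₁ C₁⊂C) A∩⊆⊥) id)
            (indep-⊆ R (⊆-by 3 (λ a c s → ⊢ c :∪ (a :─ s) ≼ c :∪ a) A C₁ ⁅ b ⁆) C₁∪A-indep)
            (bound R (A - b)) (unlinked b∈A))

        delete-A : ∀ {b} → b ∈ A → Indep ρ (D₁ ∪ ((C₁ ∪ A) - b))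
        delete-A {b} b∈A = ∪-indep R {B′ = (A - b) ∪ D₁} (C₁-indep b∈A)
          (⊆-by 4 (λ a d d₁ s → d₁ ≼ d ⇒ ⊢ (a :─ s) :∪ d₁ ≼ (a :─ s) :∪ d) A D D₁ ⁅ b ⁆ (proj₁ D₁⊂D))
          (indep-⊆ R (⊆-by 3 (λ a d s → ⊢ (a :─ s) :∪ d ≼ a :∪ d) A D₁ ⁅ b ⁆) A∪D₁-indep)
          (⊆-by 4 (λ a c d s → ⊢ d :∪ ((c :∪ a) :─ s) ≼ c :∪ ((a :─ s) :∪ d)) A C₁ D₁ ⁅ b ⁆)

        D₁-disjoint : D₁ ∩ (C₁ ∪ A) ⊆ ⊥
        D₁-disjoint = ⊆-by 5 (λ a c d c₁ d₁ → c₁ ≼ c ⇒ d₁ ≼ d ⇒ c :∩ d ≼ ∅ ⇒ a :∩ (c :∪ d) ≼ ∅ ⇒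
            ⊢ d₁ :∩ (c₁ :∪ a) ≼ ∅)
          A C D C₁ D₁ (proj₁ C₁⊂C) (proj₁ D₁⊂D) C∩D⊆⊥ A∩⊆⊥

        -- Deletions in `C₁` succeed because `C₁` is a circuit over `A ∪ D`, deletions in `A`
        -- because of the minimality of `A`.
        glued : Circ ρ (D₁ ∪ (C₁ ∪ A))
        glued = ∪-circ R d₁ D₁-disjoint C₁∪A-indep λ {b} b∈ → case x∈p∪q⁻ C₁ A b∈ of λ where
          (inj₁ b∈C₁) → delete-C₁ b∈C₁
          (inj₂ b∈A)  → delete-A b∈A

        glued-size : ∀ {a} → a ∈ A → ∣ C ∣ ≤ ∣ C₁ ∣ + ∣ C₁ ∣ → ∣ D ∣ ≤ ∣ D₁ ∣ + ∣ D₁ ∣ →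
                     ∣ C ∣ + ∣ D ∣ + 2 ≤ ∣ D₁ ∪ (C₁ ∪ A) ∣ + ∣ D₁ ∪ (C₁ ∪ A) ∣
        -- The claim is about twice the size of the union, so the facts on disjoint unions are
        -- listed twice. The 2 comes from counting the nonempty `A` twice.
        glued-size {a} a∈A hC hD = ≤-by 8 (λ c d c₁ d₁ a b x a′ →
            c ≼ c₁ :+ c₁ ⇒ d ≼ d₁ :+ d₁ ⇒ a′ :+ con 1 ≼ a ⇒ a′ :+ con 1 ≼ a ⇒
            c₁ :+ a ≼ b ⇒ c₁ :+ a ≼ b ⇒ d₁ :+ b ≼ x ⇒ d₁ :+ b ≼ x ⇒ ⊢ c :+ d :+ con 2 ≼ x :+ x)
          (∣ C ∣) (∣ D ∣) (∣ C₁ ∣) (∣ D₁ ∣) (∣ A ∣) (∣ C₁ ∪ A ∣) (∣ D₁ ∪ (C₁ ∪ A) ∣) (∣ A - a ∣)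
          hC hD (card-delete-≥ a∈A) (card-delete-≥ a∈A) card-C₁∪A card-C₁∪A
          (card-disjoint D₁ (C₁ ∪ A) D₁-disjoint id) (card-disjoint D₁ (C₁ ∪ A) D₁-disjoint id)

  abstract

    long-circuit : ∀ {a} → a ∈ A →
                   ∃ λ X → Circ ρ X × (∣ C ∣ + ∣ D ∣ + 2 ≤ ∣ X ∣ + ∣ X ∣) × X ⊆ (C ∪ D) ∪ A
    long-circuit a∈A = case half-of-C a∈A of λ where
      (C₁ , (C₁⊂C , c₁) , hC) → case half-of-D C₁⊂C c₁ of λ where
        (D₁ , (D₁⊂D , d₁) , hD) → D₁ ∪ (C₁ ∪ A) , glued C₁⊂C c₁ D₁⊂D d₁ ,
          glued-size C₁⊂C c₁ D₁⊂D d₁ a∈A hC hD , λ {x} →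
          ⊆-by 5 (λ a c d c₁ d₁ → c₁ ≼ c ⇒ d₁ ≼ d ⇒ ⊢ d₁ :∪ (c₁ :∪ a) ≼ (c :∪ d) :∪ a)
            A C D C₁ D₁ (proj₁ C₁⊂C) (proj₁ D₁⊂D) {x}

-- Contracting a largest circuit, contracting inside a component, contracting one element.

module _ {n : ℕ} {ρ : Subset n → ℕ} (R : IsRank ρ) where

  abstract

    -- `Z ─ D` and `Z ─ C` are independent, their union `Z` is dependent, and they meet in
    -- `Z ─ (C ∪ D)`, so they are linked over it. Submodularity passes this on to the larger sets
    -- `A ∪ C` and `A ∪ D`.
    circuit-links : ∀ {C D Z x y} → C ∩ D ⊆ ⊥ → Circ ρ Z → x ∈ C → x ∈ Z → y ∈ D → y ∈ Z →
                    Linked ρ C D (Z ─ (C ∪ D))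
    circuit-links {C} {D} {Z} {x} {y} C∩D⊆⊥ cZ x∈C x∈Z y∈D y∈Z =
      ≤-by 12 (λ P Q PQ′ U P′ Q′ Z A p q z a →
          PQ′ :+ P′ ≼ P :+ Z ⇒ U :+ Q′ ≼ Q :+ PQ′ ⇒ p ≼ P′ ⇒ q ≼ Q′ ⇒ Z :+ con 1 ≼ z ⇒ A ≼ a ⇒
          z :+ a ≼ p :+ q ⇒ ⊢ A :+ U :+ con 1 ≼ P :+ Q)
        (ρ (A ∪ C)) (ρ (A ∪ D)) (ρ ((A ∪ C) ∪ (Z ─ C))) (ρ (A ∪ (C ∪ D))) (ρ (Z ─ D)) (ρ (Z ─ C))
        (ρ Z) (ρ A) (∣ Z ─ D ∣) (∣ Z ─ C ∣) (∣ Z ∣) (∣ A ∣)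
        (submod-⊆ R (A ∪ C) Z
          (⊆-by 3 (λ c d z → ⊢ ((z :─ (c :∪ d)) :∪ c) :∪ (z :─ c) ≼ ((z :─ (c :∪ d)) :∪ c) :∪ z) C D Z)
          (⊆-by 3 (λ c d z → ⊢ z :─ d ≼ ((z :─ (c :∪ d)) :∪ c) :∩ z) C D Z))
        (submod-⊆ R (A ∪ D) ((A ∪ C) ∪ (Z ─ C))
          (⊆-by 3 (λ c d z → ⊢ (z :─ (c :∪ d)) :∪ (c :∪ d) ≼
            ((z :─ (c :∪ d)) :∪ d) :∪ (((z :─ (c :∪ d)) :∪ c) :∪ (z :─ c))) C D Z)
          (⊆-by 3 (λ c d z → ⊢ z :─ c ≼
            ((z :─ (c :∪ d)) :∪ d) :∩ (((z :─ (c :∪ d)) :∪ c) :∪ (z :─ c))) C D Z))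
        (proper D y∈D y∈Z) (proper C x∈C x∈Z) (dependent cZ) (bound R A)
        (card-submod (Z ─ D) (Z ─ C)
          (⊆-by 3 (λ c d z → c :∩ d ≼ ∅ ⇒ ⊢ z ≼ (z :─ d) :∪ (z :─ c)) C D Z C∩D⊆⊥)
          (⊆-by 3 (λ c d z → ⊢ z :─ (c :∪ d) ≼ (z :─ d) :∩ (z :─ c)) C D Z))
      where
      A : Subset n
      A = Z ─ (C ∪ D)
      proper : ∀ X {x} → x ∈ X → x ∈ Z → Indep ρ (Z ─ X)
      proper X {x} x∈X x∈Z = circ-⊂ R cZ (p─q⊆p Z X , x , x∈Z , λ x∈ →
        ∉⊥ (⊆-by 2 (λ z x → ⊢ (z :─ x) :∩ x ≼ ∅) Z X (x∈p∩q⁺ (x∈ , x∈X))))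

    linked⇒nonempty : ∀ {C D A} → ρ C + ρ D ≤ ρ (C ∪ D) → Linked ρ C D A → Nonempty A
    linked⇒nonempty {C} {D} {A} skew linked = decidable-stable (nonempty? A) λ empty →
      let A⊆⊥ : A ⊆ ⊥
          A⊆⊥ x∈ = ⊥-elim (empty (_ , x∈))
      in 1+n≰n (≤-by 7 (λ rA U AC AD C D CD →
             C :+ D ≼ CD ⇒ rA :+ U :+ con 1 ≼ AC :+ AD ⇒ CD ≼ U ⇒ AC ≼ C ⇒ AD ≼ D ⇒ ⊢ con 1 ≼ con 0)
           (ρ A) (ρ (A ∪ (C ∪ D))) (ρ (A ∪ C)) (ρ (A ∪ D)) (ρ C) (ρ D) (ρ (C ∪ D))
           skew linked (mono R (q⊆p∪q A (C ∪ D)))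
           (mono R (⊆-by 2 (λ a x → a ≼ ∅ ⇒ ⊢ a :∪ x ≼ x) A C A⊆⊥))
           (mono R (⊆-by 2 (λ a x → a ≼ ∅ ⇒ ⊢ a :∪ x ≼ x) A D A⊆⊥)))

    skew-circuits : ∀ {C D Z x y} → Circ ρ C → Circ ρ D → C ∩ D ⊆ ⊥ → ρ C + ρ D ≤ ρ (C ∪ D) →
                    Circ ρ Z → x ∈ C → x ∈ Z → y ∈ D → y ∈ Z →
                    ∃ λ X → Circ ρ X × (∣ C ∣ + ∣ D ∣ + 2 ≤ ∣ X ∣ + ∣ X ∣) × X ⊆ (C ∪ D) ∪ Z
    skew-circuits {C} {D} {Z} cC cD C∩D⊆⊥ skew cZ x∈C x∈Z y∈D y∈Z =
      case minimal-subset Linked? (Z ─ (C ∪ D)) (circuit-links C∩D⊆⊥ cZ x∈C x∈Z y∈D y∈Z) of λ where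
        (A , A⊆ , linked , minimal) → case linked⇒nonempty skew linked of λ where
          (a , a∈A) → case MinimalLink.long-circuit R cC cD C∩D⊆⊥
              (⊆-by 4 (λ c d z a → a ≼ z :─ (c :∪ d) ⇒ ⊢ a :∩ (c :∪ d) ≼ ∅) C D Z A A⊆)
              linked minimal a∈A of λ where
            (X , cX , size , X⊆) → X , cX , size , λ {x} →
              ⊆-by 5 (λ c d z a x → a ≼ z :─ (c :∪ d) ⇒ x ≼ (c :∪ d) :∪ a ⇒ ⊢ x ≼ (c :∪ d) :∪ z)
                C D Z A X A⊆ X⊆ {x}
      where
      Linked? : ∀ A → Dec (Linked ρ C D A)
      Linked? A = ρ A + ρ (A ∪ (C ∪ D)) + 1 ≤? ρ (A ∪ C) + ρ (A ∪ D)

    largest-circuit-contract : ∀ {E C D} →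
      (∀ {e f} → e ∈ E → f ∈ E → e ≡ f ⊎ ∃ λ Z → (Circ ρ Z × Z ⊆ E) × e ∈ Z × f ∈ Z) →
      Circ ρ C → C ⊆ E → (∀ {X} → Circ ρ X → X ⊆ E → ∣ X ∣ ≤ ∣ C ∣) →
      Circ (ρ ⫽ C) D → D ⊆ E → D ∩ C ⊆ ⊥ → ∣ D ∣ + 1 ≤ ∣ C ∣
    largest-circuit-contract {E} {C} {D} connected cC C⊆E largest cD/C D⊆E D∩C⊆⊥ =
      case circ-nonempty R cC of λ where
        (x , x∈C) → case ∣ D ∣ ≤? ρ D of λ where
          (yes iD) → case extend-circuit R cC cD/C D∩C⊆⊥ iD x∈C of λ where
            (X , cX , x∈X , D⊆X , X⊆) →
              ≤-by 4 (λ d x′ x c → d ≼ x′ ⇒ x′ :+ con 1 ≼ x ⇒ x ≼ c ⇒ ⊢ d :+ con 1 ≼ c)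
                (∣ D ∣) (∣ X - x ∣) (∣ X ∣) (∣ C ∣)
                (p⊆q⇒∣p∣≤∣q∣ (⊆-delete D⊆X λ x∈D → disjoint x∈D x∈C)) (card-delete-≥ x∈X)
                (largest cX (⊆-by 4 (λ e c d x → c ≼ e ⇒ d ≼ e ⇒ x ≼ c :∪ d ⇒ ⊢ x ≼ e)
                  E C D X C⊆E D⊆E X⊆))
          (no ¬iD) → case circ-nonempty (⫽-isRank R C) cD/C of λ where
            (y , y∈D) → case connected (C⊆E x∈C) (D⊆E y∈D) of λ where
              (inj₁ x≡y) → ⊥-elim (disjoint y∈D (subst (_∈ C) x≡y x∈C))
              (inj₂ (Z , (cZ , Z⊆E) , x∈Z , y∈Z)) →
                case skew-circuits cC (cD ¬iD) C∩D⊆⊥ (skew ¬iD) cZ x∈C x∈Z y∈D y∈Z of λ where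
                  (X , cX , size , X⊆) →
                    ≤-by 3 (λ c d x → c :+ d :+ con 2 ≼ x :+ x ⇒ x ≼ c ⇒ x ≼ c ⇒ ⊢ d :+ con 1 ≼ c)
                      (∣ C ∣) (∣ D ∣) (∣ X ∣) size
                      (largest cX (inside-E X Z Z⊆E X⊆)) (largest cX (inside-E X Z Z⊆E X⊆))
      where
      disjoint : ∀ {z} → z ∈ D → z ∉ C
      disjoint z∈D z∈C = ∉⊥ (D∩C⊆⊥ (x∈p∩q⁺ (z∈D , z∈C)))
      C∩D⊆⊥ : C ∩ D ⊆ ⊥
      C∩D⊆⊥ = ⊆-by 2 (λ c d → d :∩ c ≼ ∅ ⇒ ⊢ c :∩ d ≼ ∅) C D D∩C⊆⊥
      inside-E : ∀ X Z → Z ⊆ E → X ⊆ (C ∪ D) ∪ Z → X ⊆ E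
      inside-E X Z Z⊆E X⊆ =
        ⊆-by 5 (λ e c d z x → c ≼ e ⇒ d ≼ e ⇒ z ≼ e ⇒ x ≼ (c :∪ d) :∪ z ⇒ ⊢ x ≼ e)
          E C D Z X C⊆E D⊆E Z⊆E X⊆
      cD : ¬ Indep ρ D → Circ ρ D
      cD ¬iD = circ (¬Indep⇒Dep {ρ = ρ} ¬iD) λ {y} y∈D →
        ∪-indep R (delete cD/C y∈D) (⊆-min C) (indep-⊥ R) (p⊆p∪q ⊥)
      -- A dependent `D` has rank at most its size minus 1, which is its rank over `C`; contracting
      -- `C` therefore costs `D` no rank.
      skew : ¬ Indep ρ D → ρ C + ρ D ≤ ρ (C ∪ D)
      skew ¬iD = ≤-by 6 (λ g c d u v D →
          d :+ con 1 ≼ D ⇒ D ≼ g :+ con 1 ⇒ g :+ c ≼ u ⇒ u ≼ v ⇒ ⊢ c :+ d ≼ v)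
        ((ρ ⫽ C) D) (ρ C) (ρ D) (ρ (D ∪ C)) (ρ (C ∪ D)) (∣ D ∣)
        (¬Indep⇒Dep {ρ = ρ} ¬iD) (circ-rank (⫽-isRank R C) cD/C) (⫽-≤ R C D)
        (mono R (⊆-by 2 (λ x y → ⊢ x :∪ y ≼ y :∪ x) D C))

    ⫽-antitone : ∀ {B B′} X → B′ ⊆ B → (ρ ⫽ B) X ≤ (ρ ⫽ B′) X
    ⫽-antitone {B} {B′} X B′⊆B =
      ≤-by 6 (λ f g b b′ u u′ → f :+ b ≼ u ⇒ u′ ≼ g :+ b′ ⇒ u :+ b′ ≼ u′ :+ b ⇒ ⊢ f ≼ g)
        ((ρ ⫽ B) X) ((ρ ⫽ B′) X) (ρ B) (ρ B′) (ρ (X ∪ B)) (ρ (X ∪ B′))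
        (⫽-≤ R B X) (⫽-≥ R B′ X)
        (submod-⊆ R (X ∪ B′) B
          (⊆-by 3 (λ x b b′ → ⊢ x :∪ b ≼ (x :∪ b′) :∪ b) X B B′)
          (⊆-by 3 (λ x b b′ → b′ ≼ b ⇒ ⊢ b′ ≼ (x :∪ b′) :∩ b) X B B′ B′⊆B))

    ρ-cong : ∀ {X Y} → X ⊆ Y → Y ⊆ X → ρ X ≡ ρ Y
    ρ-cong X⊆Y Y⊆X = ≤-antisym (mono R X⊆Y) (mono R Y⊆X)

    ⫽-⊥ : ∀ X → ρ X ≡ (ρ ⫽ ⊥) X
    ⫽-⊥ X = sym (cong₂ _∸_
        (ρ-cong (⊆-by 1 (λ x → ⊢ x :∪ ∅ ≼ x) X) (p⊆p∪q ⊥))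
        (n≤0⇒n≡0 (≤-trans (bound R ⊥) (≤-reflexive (∣⊥∣≡0 n)))))

    ⫽-⫽ : ∀ {S e} → e ∈ S → ∀ X → ((ρ ⫽ ⁅ e ⁆) ⫽ (S - e)) X ≡ (ρ ⫽ S) X
    ⫽-⫽ {S} {e} e∈S X = begin
      (ρ ((X ∪ (S - e)) ∪ ⁅ e ⁆) ∸ ρ ⁅ e ⁆) ∸ (ρ ((S - e) ∪ ⁅ e ⁆) ∸ ρ ⁅ e ⁆)
        ≡⟨ ∸-+-assoc _ (ρ ⁅ e ⁆) _ ⟩
      ρ ((X ∪ (S - e)) ∪ ⁅ e ⁆) ∸ (ρ ⁅ e ⁆ + (ρ ((S - e) ∪ ⁅ e ⁆) ∸ ρ ⁅ e ⁆))
        ≡⟨ cong (ρ ((X ∪ (S - e)) ∪ ⁅ e ⁆) ∸_) (m+[n∸m]≡n (mono R (q⊆p∪q (S - e) ⁅ e ⁆))) ⟩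
      ρ ((X ∪ (S - e)) ∪ ⁅ e ⁆) ∸ ρ ((S - e) ∪ ⁅ e ⁆)
        ≡⟨ cong₂ _∸_
             (ρ-cong (⊆-by 3 (λ x s t → t ≼ s ⇒ ⊢ (x :∪ (s :─ t)) :∪ t ≼ x :∪ s) X S ⁅ e ⁆ (⁅⁆⊆ e∈S))
                     (⊆-by 3 (λ x s t → ⊢ x :∪ s ≼ (x :∪ (s :─ t)) :∪ t) X S ⁅ e ⁆))
             (ρ-cong (⊆-by 2 (λ s t → t ≼ s ⇒ ⊢ (s :─ t) :∪ t ≼ s) S ⁅ e ⁆ (⁅⁆⊆ e∈S))
                     (⊆-by 2 (λ s t → ⊢ s ≼ (s :─ t) :∪ t) S ⁅ e ⁆)) ⟩
      ρ (X ∪ S) ∸ ρ S ∎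
      where open ≡-Reasoning

    basis : ∀ S → ∃ λ B → B ⊆ S × Indep ρ B × ρ S ≤ ρ B
    basis S = case minimal-subset (λ Y → ρ S ≤? ρ Y) S ≤-refl of λ where
      (B , B⊆S , spans , minimal) → B , (λ {x} → B⊆S {x}) ,
        coloops⇒indep R (λ {b} b∈B → ≤-trans
          (subst (_≤ ρ S) (+-comm 1 (ρ (B - b))) (≰⇒> (minimal b∈B))) spans) ,
        spans

    circ? : ∀ C → Dec (Circ ρ C)
    circ? C = map′ to from
      ((ρ C + 1 ≤? ∣ C ∣) ×-dec Lift? (λ x → ∣ C - x ∣ ≤? ρ (C - x)) C)
      where
      to : Dep ρ C × Lift (λ x → Indep ρ (C - x)) C → Circ ρ C
      to (d , i) = circ d i
      from : Circ ρ C → Dep ρ C × Lift (λ x → Indep ρ (C - x)) C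
      from (circ d i) = d , i

    -- K is closed under meeting circuits, so a circuit witnessing a dependency over S that meets
    -- K uses only the elements of S in K.
    component-contract : ∀ {E K S D} → (∀ {X x} → Circ ρ X → X ⊆ E → x ∈ X → x ∈ K → X ⊆ K) →
      K ⊆ E → S ⊆ E → Circ (ρ ⫽ (S ∩ K)) D → D ⊆ K → D ∩ S ⊆ ⊥ → Circ (ρ ⫽ S) D
    component-contract {E} {K} {S} {D} closed K⊆E S⊆E c D⊆K D∩S⊆⊥ = circ
      (≤-trans (+-monoˡ-≤ 1 (⫽-antitone D (p∩q⊆p S K))) (dependent c))
      -- A basis `B` of `S` turns a dependency over `S` into a circuit `X` of `ρ` inside
      -- `(D - x) ∪ B`. As `B` is independent, `X` has an element outside `B`, hence in `K`.
      λ {x} x∈D → ¬Dep⇒Indep {ρ = ρ ⫽ S} λ dep → case basis S of λ where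
        (B , B⊆S , iB , spans) → case dep⇒circ R (lift x dep B B⊆S iB spans) of λ where
          (X , X⊆ , cX) → case ∃∉ X B (λ X⊆B → dep⇒¬indep {ρ = ρ} (dependent cX) (indep-⊆ R X⊆B iB)) of λ where
            (z , z∈X , z∉B) → case x∈p∪q⁻ (D - x) B (X⊆ z∈X) of λ where
              (inj₂ z∈B) → z∉B z∈B
              (inj₁ z∈D) → dep⇒¬indep {ρ = ρ} (dependent cX)
                (confined x x∈D X B X⊆ B⊆S iB
                  (closed cX (in-E x X B B⊆S X⊆) z∈X (D⊆K (p─q⊆p D ⁅ x ⁆ z∈D))))
      where
      lift : ∀ x → Dep (ρ ⫽ S) (D - x) → ∀ B → B ⊆ S → Indep ρ B → ρ S ≤ ρ B → Dep ρ ((D - x) ∪ B)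
      lift x dep B B⊆S iB spans = ≤-by 8 (λ u v f S B b d w →
          u ≼ v ⇒ v ≼ f :+ S ⇒ f :+ con 1 ≼ d ⇒ S ≼ B ⇒ B ≼ b ⇒ d :+ b ≼ w ⇒ ⊢ u :+ con 1 ≼ w)
        (ρ ((D - x) ∪ B)) (ρ ((D - x) ∪ S)) ((ρ ⫽ S) (D - x)) (ρ S) (ρ B) (∣ B ∣) (∣ D - x ∣) (∣ (D - x) ∪ B ∣)
        (mono R (⊆-by 3 (λ d s b → b ≼ s ⇒ ⊢ d :∪ b ≼ d :∪ s) (D - x) S B B⊆S))
        (⫽-≥ R S (D - x)) dep spans (bound R B)
        (card-disjoint (D - x) B
          (⊆-by 4 (λ d s b t → d :∩ s ≼ ∅ ⇒ b ≼ s ⇒ ⊢ (d :─ t) :∩ b ≼ ∅) D S B ⁅ x ⁆ D∩S⊆⊥ B⊆S) id)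
      in-E : ∀ x X B → B ⊆ S → X ⊆ (D - x) ∪ B → X ⊆ E
      in-E x X B B⊆S X⊆ = ⊆-by 7 (λ e k s d b t x →
          k ≼ e ⇒ s ≼ e ⇒ d ≼ k ⇒ b ≼ s ⇒ x ≼ (d :─ t) :∪ b ⇒ ⊢ x ≼ e)
        E K S D B ⁅ x ⁆ X K⊆E S⊆E D⊆K B⊆S X⊆
      confined : ∀ x → x ∈ D → ∀ X B → X ⊆ (D - x) ∪ B → B ⊆ S → Indep ρ B → X ⊆ K → Indep ρ X
      confined x x∈D X B X⊆ B⊆S iB X⊆K = ∪-indep R {B′ = X ∩ B} (delete c x∈D)
        (⊆-by 4 (λ k s b x → x ≼ k ⇒ b ≼ s ⇒ ⊢ x :∩ b ≼ s :∩ k) K S B X X⊆K B⊆S)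
        (indep-⊆ R (p∩q⊆q X B) iB)
        (⊆-by 3 (λ d b x → x ≼ d :∪ b ⇒ ⊢ x ≼ d :∪ (x :∩ b)) (D - x) B X X⊆)

    -- `D` is `C - e` if `e` lies in `C`, the larger of two covering circuits if contracting `e`
    -- creates nullity 2, and `C` itself otherwise. The first alternative is the loop `⁅ e ⁆`, which
    -- contraction destroys.
    contract-element : ∀ {C} e → Circ ρ C →
      ∣ C ∣ ≤ 1 ⊎ ∃ λ D → Circ (ρ ⫽ ⁅ e ⁆) D × D ⊆ C - e × ∣ C ∣ ≤ ∣ D ∣ + ∣ D ∣
    contract-element {C} e c = case e ∈? C of λ where
        (yes e∈C) → case nonempty? (C - e) of λ where
          (yes (x , x∈)) → inj₂ (C - e , inside-circ e∈C x∈ , (λ {z} → ⊆-refl {x = C - e} {z}) ,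
            ≤-by 3 (λ c d d′ → c ≼ d :+ con 1 ⇒ d′ :+ con 1 ≼ d ⇒ ⊢ c ≼ d :+ d)
              (∣ C ∣) (∣ C - e ∣) (∣ C - e - x ∣) (card-delete-≤ C e) (card-delete-≥ x∈))
          (no  empty)    → inj₁ (≤-trans (card-delete-≤ C e) (+-monoˡ-≤ 1
            (≤-reflexive (trans (cong ∣_∣ (Empty-unique empty)) (∣⊥∣≡0 n)))))
        (no  e∉C) → case (ρ ⫽ ⁅ e ⁆) C + 2 ≤? ∣ C ∣ of λ where
          (yes h₂) → case large-circuit (⫽-isRank R ⁅ e ⁆) {C} h₂ nullity-del of λ where
            (D , (D⊂C , cD) , size) → inj₂ (D , cD , (λ {x} → ⊆-delete (proj₁ D⊂C) (e∉C ∘ proj₁ D⊂C) {x}) , size)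
          (no ¬h₂) → inj₂ (C , outside-circ ¬h₂ , (λ {x} → ⊆-delete id e∉C {x}) , m≤m+n ∣ C ∣ ∣ C ∣)
      where
      ∣e∣≤1 : ∣ ⁅ e ⁆ ∣ ≤ 1
      ∣e∣≤1 = ≤-reflexive (∣⁅x⁆∣≡1 e)
      1≤∣e∣ : 1 ≤ ∣ ⁅ e ⁆ ∣
      1≤∣e∣ = ≤-reflexive (sym (∣⁅x⁆∣≡1 e))
      nullity-del : ∀ {x} → x ∈ C → ∣ C ∣ ≤ (ρ ⫽ ⁅ e ⁆) (C - x) + 2
      nullity-del {x} x∈C = ≤-by 7 (λ c d rd u f re e →
          c ≼ d :+ con 1 ⇒ d ≼ rd ⇒ rd ≼ u ⇒ u ≼ f :+ re ⇒ re ≼ e ⇒ e ≼ con 1 ⇒ ⊢ c ≼ f :+ con 2)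
        (∣ C ∣) (∣ C - x ∣) (ρ (C - x)) (ρ ((C - x) ∪ ⁅ e ⁆)) ((ρ ⫽ ⁅ e ⁆) (C - x)) (ρ ⁅ e ⁆) (∣ ⁅ e ⁆ ∣)
        (card-delete-≤ C x) (delete c x∈C) (mono R (p⊆p∪q ⁅ e ⁆)) (⫽-≥ R ⁅ e ⁆ (C - x)) (bound R ⁅ e ⁆) ∣e∣≤1
      outside-circ : ¬ ((ρ ⫽ ⁅ e ⁆) C + 2 ≤ ∣ C ∣) → Circ (ρ ⫽ ⁅ e ⁆) C
      outside-circ ¬h₂ = circ
        (≤-by 5 (λ f u r re c → f :+ re ≼ u ⇒ u ≼ re :+ r ⇒ r :+ con 1 ≼ c ⇒ ⊢ f :+ con 1 ≼ c)
          ((ρ ⫽ ⁅ e ⁆) C) (ρ (C ∪ ⁅ e ⁆)) (ρ C) (ρ ⁅ e ⁆) (∣ C ∣)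
          (⫽-≤ R ⁅ e ⁆ C) subadditive (dependent c))
        λ {x} x∈C → ≤-by 4 (λ d c f g → d :+ con 1 ≼ c ⇒ c ≼ f :+ con 1 ⇒ f ≼ g ⇒ ⊢ d ≼ g)
          (∣ C - x ∣) (∣ C ∣) ((ρ ⫽ ⁅ e ⁆) C) ((ρ ⫽ ⁅ e ⁆) (C - x))
          (card-delete-≥ x∈C)
          (¬+1≤⇒≥ (λ h → ¬h₂ (subst (_≤ ∣ C ∣) (+-assoc ((ρ ⫽ ⁅ e ⁆) C) 1 1) h)))
          (∸-monoˡ-≤ (ρ ⁅ e ⁆) (circ-closure R c x∈C (p⊆p∪q ⁅ e ⁆)
            (⊆-by 3 (λ c s t → ⊢ c :∪ t ≼ ((c :─ s) :∪ t) :∪ c) C ⁅ x ⁆ ⁅ e ⁆)))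
        where
        subadditive : ρ (C ∪ ⁅ e ⁆) ≤ ρ ⁅ e ⁆ + ρ C
        subadditive = ≤-trans (m≤m+n _ (ρ ⊥))
          (submod-⊆ R ⁅ e ⁆ C (⊆-by 2 (λ c t → ⊢ c :∪ t ≼ t :∪ c) C ⁅ e ⁆) (⊆-min _))
      inside-circ : e ∈ C → ∀ {x} → x ∈ C - e → Circ (ρ ⫽ ⁅ e ⁆) (C - e)
      inside-circ e∈C {x} x∈ = circ
        (≤-by 7 (λ f re u r c d e → f :+ re ≼ u ⇒ u ≼ r ⇒ r :+ con 1 ≼ c ⇒ c ≼ d :+ con 1 ⇒
            con 1 ≼ e ⇒ e ≼ re ⇒ ⊢ f :+ con 1 ≼ d)
          ((ρ ⫽ ⁅ e ⁆) (C - e)) (ρ ⁅ e ⁆) (ρ ((C - e) ∪ ⁅ e ⁆)) (ρ C) (∣ C ∣) (∣ C - e ∣) (∣ ⁅ e ⁆ ∣)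
          (⫽-≤ R ⁅ e ⁆ (C - e))
          (mono R (⊆-by 2 (λ c t → t ≼ c ⇒ ⊢ (c :─ t) :∪ t ≼ c) C ⁅ e ⁆ (⁅⁆⊆ e∈C)))
          (dependent c) (card-delete-≤ C e) 1≤∣e∣
          (circ-⊂ R c (⁅⁆⊆ e∈C , x , p─q⊆p C ⁅ e ⁆ x∈ , λ x∈e →
            ∉-delete C e (subst (_∈ C - e) (x∈⁅y⁆⇒x≡y e x∈e) x∈))))
        λ {y} y∈ → indep-contract R
          (≤-by 6 (λ d re e k rk u → re ≼ e ⇒ d :+ e ≼ k ⇒ k ≼ rk ⇒ rk ≼ u ⇒ ⊢ d :+ re ≼ u)
            (∣ C - e - y ∣) (ρ ⁅ e ⁆) (∣ ⁅ e ⁆ ∣) (∣ C - y ∣) (ρ (C - y)) (ρ ((C - e - y) ∪ ⁅ e ⁆))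
            (bound R ⁅ e ⁆)
            (card-disjoint (C - e - y) ⁅ e ⁆
              (⊆-by 3 (λ c s t → ⊢ ((c :─ t) :─ s) :∩ t ≼ ∅) C ⁅ y ⁆ ⁅ e ⁆)
              (⊆-by 3 (λ c s t → s ≼ c :─ t ⇒ t ≼ c ⇒ ⊢ ((c :─ t) :─ s) :∪ t ≼ c :─ s) C ⁅ y ⁆ ⁅ e ⁆
                (⁅⁆⊆ y∈) (⁅⁆⊆ e∈C)))
            (delete c (p─q⊆p C ⁅ e ⁆ y∈))
            (mono R (⊆-by 3 (λ c s t → ⊢ c :─ s ≼ ((c :─ t) :─ s) :∪ t) C ⁅ y ⁆ ⁅ e ⁆)))

abstract

  circ-cong : ∀ {n} {ρ σ : Subset n → ℕ} → (∀ X → ρ X ≡ σ X) → ∀ {C} → Circ ρ C → Circ σ C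
  circ-cong ρ≗σ {C} c = circ (subst (λ r → r + 1 ≤ ∣ C ∣) (ρ≗σ C) (dependent c))
    λ {x} x∈C → subst (∣ C - x ∣ ≤_) (ρ≗σ (C - x)) (delete c x∈C)

-- Matroids, circuits and components in terms of a total rank function.

abstract

  comprehension : ∀ {n} {P : Fin n → Set} → (∀ x → Dec (P x)) →
                  ∃ λ K → ∀ x → (x ∈ K → P x) × (P x → x ∈ K)
  comprehension {P = P} P? = tabulate (λ x → does (P? x)) , λ x → to x , from x
    where
    does-true : ∀ {A : Set} (a? : Dec A) → does a? ≡ true → A
    does-true (yes a) _ = a
    to : ∀ x → x ∈ tabulate (λ x → does (P? x)) → P x
    to x x∈ = does-true (P? x) (trans (sym (lookup∘tabulate (λ x → does (P? x)) x)) ([]=⇒lookup x∈))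
    from : ∀ x → P x → x ∈ tabulate (λ x → does (P? x))
    from x p = lookup⇒[]= x _ (trans (lookup∘tabulate (λ x → does (P? x)) x) (dec-true (P? x) p))

record Represents {n : ℕ} (M : RawMatroid n) (ρ : Subset n → ℕ) : Set where
  field
    isRank : IsRank ρ
    agrees : ∀ {X} → X ⊆ E M → r M X ≡ ρ X

open Represents

module _ {n : ℕ} {M : RawMatroid n} where

  abstract

    -- Elements outside the ground set become loops.
    rank-extension : IsMatroid M → Represents M (λ X → r M (X ∩ E M))
    rank-extension isM .isRank .bound X =
      ≤-trans (IsMatroid.r-bound isM (X ∩ E M) (p∩q⊆q X (E M))) (p⊆q⇒∣p∣≤∣q∣ (p∩q⊆p X (E M)))
    rank-extension isM .isRank .mono {X} {Y} X⊆Y =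
      IsMatroid.r-mono isM (X ∩ E M) (Y ∩ E M)
        (⊆-by 3 (λ x y e → x ≼ y ⇒ ⊢ x :∩ e ≼ y :∩ e) X Y (E M) X⊆Y) (p∩q⊆q Y (E M))
    rank-extension isM .isRank .submod X Y = ≤-trans
      (+-mono-≤
        (IsMatroid.r-mono isM _ _
          (⊆-by 3 (λ x y e → ⊢ (x :∪ y) :∩ e ≼ (x :∩ e) :∪ (y :∩ e)) X Y (E M))
          (⊆-by 3 (λ x y e → ⊢ (x :∩ e) :∪ (y :∩ e) ≼ e) X Y (E M)))
        (IsMatroid.r-mono isM _ _
          (⊆-by 3 (λ x y e → ⊢ (x :∩ y) :∩ e ≼ (x :∩ e) :∩ (y :∩ e)) X Y (E M))
          (⊆-by 3 (λ x y e → ⊢ (x :∩ e) :∩ (y :∩ e) ≼ e) X Y (E M))))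
      (IsMatroid.r-submod isM (X ∩ E M) (Y ∩ E M) (p∩q⊆q X (E M)) (p∩q⊆q Y (E M)))
    rank-extension isM .agrees {X} X⊆E = cong (r M)
      (⊆-antisym (⊆-by 2 (λ x e → x ≼ e ⇒ ⊢ x ≼ x :∩ e) X (E M) X⊆E) (p∩q⊆p X (E M)))

module _ {n : ℕ} {M : RawMatroid n} {ρ : Subset n → ℕ} (rep : Represents M ρ) where

  private
    R : IsRank ρ
    R = isRank rep

  abstract

    represents-∣ʳ : ∀ {K} → K ⊆ E M → Represents (M ∣ʳ K) ρ
    represents-∣ʳ K⊆E .isRank = R
    represents-∣ʳ K⊆E .agrees X⊆K = agrees rep (⊆-trans X⊆K K⊆E)

    represents-／ : ∀ {e} → e ∈ E M → Represents (M ／ e) (ρ ⫽ ⁅ e ⁆)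
    represents-／ {e} e∈E .isRank = ⫽-isRank R ⁅ e ⁆
    represents-／ {e} e∈E .agrees {X} X⊆ = cong₂ _∸_
      (agrees rep (⊆-by 3 (λ e x s → x ≼ e :─ s ⇒ s ≼ e ⇒ ⊢ x :∪ s ≼ e) (E M) X ⁅ e ⁆ X⊆ (⁅⁆⊆ e∈E)))
      (agrees rep (⁅⁆⊆ e∈E))

    circuit⇒circ : ∀ {C} → Circuit M C → Circ ρ C × C ⊆ E M
    circuit⇒circ {C} ((C⊆E , dep) , proper) =
      circ (subst (_≤ ∣ C ∣) (+-comm 1 (ρ C)) (≤∧≢⇒< (bound R C) (dep ∘ trans (agrees rep C⊆E))))
        (λ {x} x∈C → case proper (C - x) (x∈p⇒p-x⊂p x∈C) of λ where
          (⊆E , indep) → ≤-reflexive (trans (sym indep) (agrees rep ⊆E))) ,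
      λ {x} → C⊆E {x}

    circ⇒circuit : ∀ {C} → Circ ρ C → C ⊆ E M → Circuit M C
    circ⇒circuit {C} c C⊆E =
      (C⊆E , λ eq → dep⇒¬indep {ρ = ρ} (dependent c)
        (≤-reflexive (trans (sym eq) (agrees rep C⊆E)))) ,
      λ D D⊂C → (λ {x} x∈D → C⊆E {x} (proj₁ D⊂C x∈D)) ,
        trans (agrees rep (λ {x} x∈D → C⊆E {x} (proj₁ D⊂C x∈D)))
          (≤-antisym (bound R D) (circ-⊂ R c D⊂C))

    circuit? : ∀ C → Dec (Circuit M C)
    circuit? C = map′ (λ (c , C⊆E) → circ⇒circuit c C⊆E) circuit⇒circ (circ? R C ×-dec (C ⊆? E M))

    related? : ∀ e f → Dec (Related M e f)
    related? e f = (e ≟ᶠ f) ⊎-dec anySubset? λ C → circuit? C ×-dec ((e ∈? C) ×-dec (f ∈? C))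

    related-sym : ∀ {e f} → Related M e f → Related M f e
    related-sym (inj₁ e≡f)                   = inj₁ (sym e≡f)
    related-sym (inj₂ (C , c , e∈C , f∈C)) = inj₂ (C , c , f∈C , e∈C)

    related-trans : ∀ {e f g} → Related M e f → Related M f g → Related M e g
    related-trans (inj₁ refl) f~g         = f~g
    related-trans e~f@(inj₂ _) (inj₁ refl) = e~f
    related-trans (inj₂ (C₁ , k₁ , e∈ , f∈₁)) (inj₂ (C₂ , k₂ , f∈₂ , g∈)) =
      case circuit⇒circ k₁ of λ where
        (c₁ , C₁⊆E) → case circuit⇒circ k₂ of λ where
          (c₂ , C₂⊆E) → case circuits-transitive R c₁ e∈ f∈₁ c₂ f∈₂ g∈ of λ where
            (X , cX , e∈X , g∈X , X⊆) → inj₂ (X ,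
              circ⇒circuit cX (⊆-by 4 (λ a b e x → a ≼ e ⇒ b ≼ e ⇒ x ≼ a :∪ b ⇒ ⊢ x ≼ e)
                C₁ C₂ (E M) X C₁⊆E C₂⊆E X⊆) ,
              e∈X , g∈X)

    -- Which constructor of `CdLe` applies depends on connectedness, so the upper bound has to
    -- decide it; all quantifiers involved are finite.
    connected? : Dec (Connected M)
    connected? = map′ (λ h e f e∈ f∈ → h e f (e∈ , f∈)) (λ h e f (e∈ , f∈) → h e f e∈ f∈)
      (allᶠ? λ e → allᶠ? λ f → ((e ∈? E M) ×-dec (f ∈? E M)) →-dec related? e f)

    component-of : ∀ {e} → e ∈ E M →
                   ∃ λ K → ∀ f → (f ∈ K → f ∈ E M × Related M e f) × (f ∈ E M × Related M e f → f ∈ K)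
    component-of {e} e∈E = comprehension λ f → (f ∈? E M) ×-dec related? e f

    component-⊆ : ∀ {K} → IsComponent M K → K ⊆ E M
    component-⊆ (e , e∈E , spec) {f} f∈K = proj₁ (proj₁ (spec f) f∈K)

    component-closed : ∀ {K} → IsComponent M K →
                       ∀ {X x} → Circ ρ X → X ⊆ E M → x ∈ X → x ∈ K → X ⊆ K
    component-closed (e , e∈E , spec) {X} {x} cX X⊆E x∈X x∈K {y} y∈X = proj₂ (spec y)
      (X⊆E y∈X , related-trans (proj₂ (proj₁ (spec x) x∈K))
                   (inj₂ (X , circ⇒circuit cX X⊆E , x∈X , y∈X)))

    -- All elements of a component are related to one root, so a component filling the ground set
    -- would make the matroid connected. This makes the recursion on components terminate.
    component-< : ∀ {K} → ¬ Connected M → IsComponent M K → ∣ K ∣ + 1 ≤ ∣ E M ∣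
    component-< {K} disc comp@(e , e∈E , spec) = case E M ⊆? K of λ where
      (yes E⊆K) → ⊥-elim (disc λ f g f∈ g∈ → related-trans
        (related-sym (proj₂ (proj₁ (spec f) (E⊆K f∈)))) (proj₂ (proj₁ (spec g) (E⊆K g∈))))
      (no E⊈K) → case ∃∉ (E M) K E⊈K of λ where
        (x , x∈E , x∉K) → ≤-trans
          (+-monoˡ-≤ 1 (p⊆q⇒∣p∣≤∣q∣ (⊆-delete (component-⊆ comp) x∉K))) (card-delete-≥ x∈E)

    connected-circ : Connected M → ∀ {e f} → e ∈ E M → f ∈ E M →
                     e ≡ f ⊎ ∃ λ Z → (Circ ρ Z × Z ⊆ E M) × e ∈ Z × f ∈ Z
    connected-circ conn {e} {f} e∈E f∈E = case conn e f e∈E f∈E of λ where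
      (inj₁ e≡f)                 → inj₁ e≡f
      (inj₂ (Z , k , e∈Z , f∈Z)) → inj₂ (Z , circuit⇒circ k , e∈Z , f∈Z)

-- Lower bound: circuit sizes against contraction depth.

abstract

  circuit-size≤2^cd : ∀ {n} {M : RawMatroid n} {k} → CdLe M k → ∀ {ρ} → Represents M ρ →
                      ∀ {C} → Circ ρ C → C ⊆ E M → ∣ C ∣ ≤ 2 ^ k
  circuit-size≤2^cd (cd-empty empty) rep c C⊆E =
    case circ-nonempty (isRank rep) c of λ where (x , x∈C) → ⊥-elim (empty x (C⊆E x∈C))
  circuit-size≤2^cd {M = M} (cd-disc disc comps) rep {C} c C⊆E =
    case circ-nonempty (isRank rep) c of λ where
      -- A circuit lies inside the component of any of its elements and remains a circuit of the
      -- restriction.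
      (x , x∈C) → case component-of rep (C⊆E x∈C) of λ where
        (K , spec) → circuit-size≤2^cd (comps K (x , C⊆E x∈C , spec))
          (represents-∣ʳ rep (component-⊆ rep (x , C⊆E x∈C , spec))) c
          (component-closed rep (x , C⊆E x∈C , spec) c C⊆E x∈C
            (proj₂ (spec x) (C⊆E x∈C , inj₁ refl)))
  circuit-size≤2^cd {M = M} {suc k} (cd-conn e conn e∈E sub) {ρ} rep {C} c C⊆E =
    case contract-element (isRank rep) e c of λ where
      (inj₁ ∣C∣≤1) → ≤-trans ∣C∣≤1 (m^n>0 2 (suc k))
      (inj₂ (D , cD , D⊆ , ∣C∣≤2∣D∣)) →
        ≤-by 3 (λ c d p → c ≼ d :+ d ⇒ d ≼ p ⇒ d ≼ p ⇒ ⊢ c ≼ p :+ (p :+ con 0))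
          (∣ C ∣) (∣ D ∣) (2 ^ k) ∣C∣≤2∣D∣ (IH D cD D⊆) (IH D cD D⊆)
    where
    IH : ∀ D → Circ (ρ ⫽ ⁅ e ⁆) D → D ⊆ C - e → ∣ D ∣ ≤ 2 ^ k
    IH D cD D⊆ = circuit-size≤2^cd sub (represents-／ rep e∈E) cD
      (⊆-by 4 (λ c e d s → c ≼ e ⇒ d ≼ c :─ s ⇒ ⊢ d ≼ e :─ s) C (E M) D ⁅ e ⁆ C⊆E D⊆)

-- Upper bound: repeated contraction of largest circuits.

triangle : ℕ → ℕ
triangle zero    = 0
triangle (suc m) = suc m + triangle m

abstract

  triangle-formula : ∀ m → triangle m ≡ m * suc m / 2
  triangle-formula m = sym (trans (cong (_/ 2) (double m)) (m*n/n≡m (triangle m) 2))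
    where
    double : ∀ m → m * suc m ≡ triangle m * 2
    double zero    = refl
    double (suc m) = begin
      suc m * suc (suc m)         ≡⟨ *-comm (suc m) (suc (suc m)) ⟩
      suc m + (suc m + m * suc m) ≡⟨ sym (+-assoc (suc m) (suc m) (m * suc m)) ⟩
      suc m + suc m + m * suc m   ≡⟨ cong₂ _+_ (sym (trans (*-comm (suc m) 2) (cong (suc m +_) (+-identityʳ (suc m))))) (double m) ⟩
      suc m * 2 + triangle m * 2  ≡⟨ sym (*-distribʳ-+ 2 (suc m) (triangle m)) ⟩
      (suc m + triangle m) * 2    ∎
      where open ≡-Reasoning

  cd-mono : ∀ {n} {M : RawMatroid n} {k l} → k ≤ l → CdLe M k → CdLe M l
  cd-mono k≤l (cd-empty empty)         = cd-empty empty
  cd-mono k≤l (cd-disc disc comps)     = cd-disc disc λ C comp → cd-mono k≤l (comps C comp)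
  cd-mono (s≤s k≤l) (cd-conn e c e∈ m) = cd-conn e c e∈ (cd-mono k≤l m)

  -- Contract S element by element; when S is exhausted, take for S a largest circuit, whose
  -- contraction leaves only shorter circuits.
  cd-bound : ∀ {n} j s {M : RawMatroid n} {ρ} → Represents M ρ → ∣ E M ∣ ≤ s → ∀ S → S ⊆ E M →
             (∀ {D} → Circ (ρ ⫽ S) D → D ⊆ E M → D ∩ S ⊆ ⊥ → ∣ D ∣ ≤ suc j) →
             CdLe M (∣ S ∣ + triangle (suc j))
  cd-bound j zero {M} rep ∣E∣≤0 S S⊆E small = cd-empty λ x x∈E → 1+n≰n
    (≤-by 2 (λ d e → d :+ con 1 ≼ e ⇒ e ≼ con 0 ⇒ ⊢ con 1 ≼ con 0)
      (∣ E M - x ∣) (∣ E M ∣) (card-delete-≥ x∈E) ∣E∣≤0)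
  -- `s` drops on passing to a component or contracting an element, `j` drops once `S` is exhausted:
  -- the pair decreases lexicographically.
  cd-bound {n} j (suc s) {M} {ρ} rep ∣E∣≤ S S⊆E small = case connected? rep of λ where
      (no disc)  → cd-disc disc (in-component disc)
      (yes conn) → case nonempty? S of λ where
        (yes (e , e∈S)) → contract-S conn e e∈S
        (no S-empty)    → case nonempty? (E M) of λ where
          (no E-empty)    → cd-empty λ x x∈E → E-empty (x , x∈E)
          (yes (e , e∈E)) → S-exhausted j (short S-empty) conn e e∈E
    where
    R : IsRank ρ
    R = isRank rep

    short : Empty S → ∀ {D} → Circ ρ D → D ⊆ E M → ∣ D ∣ ≤ suc j
    short S-empty {D} c D⊆E = small
      (subst (λ S → Circ (ρ ⫽ S) D) (sym (Empty-unique S-empty)) (circ-cong (⫽-⊥ R) c)) D⊆E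
      (λ x∈ → ⊥-elim (S-empty (_ , p∩q⊆q D S x∈)))

    in-component : ¬ Connected M → ∀ K → IsComponent M K → CdLe (M ∣ʳ K) (∣ S ∣ + triangle (suc j))
    in-component disc K comp = cd-mono
      (+-monoˡ-≤ (triangle (suc j)) (∣p∩q∣≤∣p∣ S K))
      (cd-bound j s (represents-∣ʳ rep K⊆E)
        (≤-by 3 (λ k e s → k :+ con 1 ≼ e ⇒ e ≼ con 1 :+ s ⇒ ⊢ k ≼ s) (∣ K ∣) (∣ E M ∣) s
          (component-< rep disc comp) ∣E∣≤)
        (S ∩ K) (p∩q⊆q S K)
        λ {D} cD D⊆K D∩ →
          let D∩S⊆⊥ = λ {x} → ⊆-by 3 (λ s k d → d ≼ k ⇒ d :∩ (s :∩ k) ≼ ∅ ⇒ ⊢ d :∩ s ≼ ∅) S K D D⊆K D∩ {x}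
          in small (component-contract R (component-closed rep comp) K⊆E S⊆E cD D⊆K D∩S⊆⊥)
               (⊆-trans D⊆K K⊆E) D∩S⊆⊥)
      where
      K⊆E : K ⊆ E M
      K⊆E = component-⊆ rep comp

    contract-S : Connected M → ∀ e → e ∈ S → CdLe M (∣ S ∣ + triangle (suc j))
    contract-S conn e e∈S = cd-mono
      (≤-by 3 (λ d s t → d :+ con 1 ≼ s ⇒ ⊢ con 1 :+ (d :+ t) ≼ s :+ t)
        (∣ S - e ∣) (∣ S ∣) (triangle (suc j)) (card-delete-≥ e∈S))
      (cd-conn e conn (S⊆E e∈S)
        (cd-bound j s (represents-／ rep (S⊆E e∈S))
          (≤-by 3 (λ k e s → k :+ con 1 ≼ e ⇒ e ≼ con 1 :+ s ⇒ ⊢ k ≼ s) (∣ E M - e ∣) (∣ E M ∣) s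
            (card-delete-≥ (S⊆E e∈S)) ∣E∣≤)
          (S - e) (⊆-by 3 (λ a s t → s ≼ a ⇒ ⊢ s :─ t ≼ a :─ t) (E M) S ⁅ e ⁆ S⊆E)
          λ {D} cD D⊆ D∩ → small (circ-cong (⫽-⫽ R e∈S) cD)
            (⊆-trans D⊆ (p─q⊆p (E M) ⁅ e ⁆))
            (⊆-by 4 (λ a s t d → d ≼ a :─ t ⇒ d :∩ (s :─ t) ≼ ∅ ⇒ ⊢ d :∩ s ≼ ∅) (E M) S ⁅ e ⁆ D D⊆ D∩)))

    S-exhausted : ∀ i → (∀ {D} → Circ ρ D → D ⊆ E M → ∣ D ∣ ≤ suc i) → Connected M →
                  ∀ e → e ∈ E M → CdLe M (∣ S ∣ + triangle (suc i))
    -- All circuits have at most one element, so a connected matroid has only the element `e`, and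
    -- one contraction empties it.
    S-exhausted zero short conn e e∈E = cd-mono (m≤n+m 1 ∣ S ∣)
      (cd-conn {k = 0} e conn e∈E (cd-empty λ x x∈ → case conn e x e∈E (p─q⊆p (E M) ⁅ e ⁆ x∈) of λ where
        (inj₁ refl) → ∉-delete (E M) e x∈
        (inj₂ (Z , k , e∈Z , x∈Z)) → case circuit⇒circ rep k of λ where
          (cZ , Z⊆E) → 1+n≰n
            (≤-by 3 (λ z z′ z″ → z′ :+ con 1 ≼ z ⇒ z″ :+ con 1 ≼ z′ ⇒ z ≼ con 1 ⇒ ⊢ con 1 ≼ con 0)
              (∣ Z ∣) (∣ Z - e ∣) (∣ Z - e - x ∣)
              (card-delete-≥ e∈Z)
              (card-delete-≥ (x∈p∧x≢y⇒x∈p-y x∈Z λ { refl → ∉-delete (E M) e x∈ }))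
              (short cZ Z⊆E))))
    S-exhausted (suc i) short conn e e∈E = case largest? of λ where
        -- The new budget `∣ C ∣ + triangle (suc i)` is exactly `triangle (suc (suc i))`.
        (yes (C , (cC , C⊆E) , ∣C∣≡)) → cd-mono
          (≤-trans (≤-reflexive (cong (_+ triangle (suc i)) ∣C∣≡)) (m≤n+m _ ∣ S ∣))
          (cd-bound i (suc s) rep ∣E∣≤ C C⊆E λ {D} cD D⊆E D∩C⊆⊥ →
            ≤-by 3 (λ d c i → d :+ con 1 ≼ c ⇒ c ≼ con 2 :+ i ⇒ ⊢ d ≼ con 1 :+ i) (∣ D ∣) (∣ C ∣) i
              (largest-circuit-contract R (connected-circ rep conn) cC C⊆E
                (λ cX X⊆E → ≤-trans (short cX X⊆E) (≤-reflexive (sym ∣C∣≡))) cD D⊆E D∩C⊆⊥)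
              (≤-reflexive ∣C∣≡))
        -- No circuit attains the bound, so the bound drops by one with nothing to contract.
        (no none) → cd-mono
          (≤-trans (≤-reflexive (cong (_+ triangle (suc i)) (∣⊥∣≡0 n)))
            (≤-trans (m≤n+m _ (suc (suc i))) (m≤n+m _ ∣ S ∣)))
          (cd-bound i (suc s) rep ∣E∣≤ ⊥ (⊆-min (E M)) λ {D} cD D⊆E _ →
            let c = circ-cong (λ X → sym (⫽-⊥ R X)) cD
            in s≤s⁻¹ (≤∧≢⇒< (short c D⊆E) λ eq → none (D , (c , λ {x} → D⊆E {x}) , eq)))
      where
      largest? : Dec (∃ λ C → (Circ ρ C × C ⊆ E M) × ∣ C ∣ ≡ suc (suc i))
      largest? = anySubset? λ C → (circ? R C ×-dec (C ⊆? E M)) ×-dec (∣ C ∣ ≟ suc (suc i))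

theorem5p6 : ∀ {n} (M : RawMatroid n) → IsMatroid M → (c : ℕ) →
    LargestCircuitSize M c →
    (∀ k → CdLe M k → c ≤ 2 ^ k) × CdLe M ((c * suc c) / 2)
theorem5p6 {n} M isM c largest = lower largest , upper c largest
  where
  ρ : Subset n → ℕ
  ρ X = r M (X ∩ E M)

  rep : Represents M ρ
  rep = rank-extension isM

  lower : LargestCircuitSize M c → ∀ k → CdLe M k → c ≤ 2 ^ k
  lower (inj₁ ((C , k , refl) , _)) l cd = case circuit⇒circ rep k of λ where
    (cC , C⊆E) → circuit-size≤2^cd cd rep cC C⊆E
  lower (inj₂ (_ , refl)) l cd = m^n>0 2 l

  bounded : ∀ j → (∀ {D} → Circ ρ D → D ⊆ E M → ∣ D ∣ ≤ suc j) → CdLe M (suc j * suc (suc j) / 2)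
  bounded j short = subst (CdLe M)
    (trans (cong (_+ triangle (suc j)) (∣⊥∣≡0 n)) (triangle-formula (suc j)))
    (cd-bound j ∣ E M ∣ rep ≤-refl ⊥ (⊆-min (E M)) λ cD D⊆E _ →
      short (circ-cong (λ X → sym (⫽-⊥ (isRank rep) X)) cD) D⊆E)

  upper : ∀ c → LargestCircuitSize M c → CdLe M ((c * suc c) / 2)
  -- Circuits are nonempty, so `c` is never 0.
  upper zero (inj₁ ((C , k , ∣C∣≡0) , _)) = case circuit⇒circ rep k of λ where
    (cC , _) → ⊥-elim (1+n≰n (≤-by 2 (λ r c → r :+ con 1 ≼ c ⇒ c ≼ con 0 ⇒ ⊢ con 1 ≼ con 0)
      (ρ C) (∣ C ∣) (dependent cC) (≤-reflexive ∣C∣≡0)))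
  upper (suc j) (inj₁ (_ , max)) = bounded j λ {D} cD D⊆E → max D (circ⇒circuit rep cD D⊆E)
  upper (suc .0) (inj₂ (none , refl)) = bounded 0 λ {D} cD D⊆E →
    ⊥-elim (none D (circ⇒circuit rep cD D⊆E))
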